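{- Let $n\ge 4$ be an integer and let $\Delta$ be an integer. There exists a minimally hamiltonian-connected graph of order $n$ with maximum degree $\Delta$ if and only if $3\le\Delta\le n-1$ and $\Delta\ne n-2$, where the value $\Delta=3$ occurs only if $n$ is even (that is, when $\Delta=3$ such a graph exists if and only if $n$ is even).
   Context: All graphs are finite and simple. The order of a graph is its number of vertices. A graph is hamiltonian-connected if between any two distinct vertices there is a Hamilton path. A hamiltonian-connected graph $G$ is minimally hamiltonian-connected if for every edge $e\in E(G)$, the graph $G-e$ is not hamiltonian-connected. -}

module Defs where

open import Data.Nat using (ℕ; zero; suc; _≤_)
open import Data.Fin using (Fin; _≟_)
open import Data.Bool using (Bool; true; false; _∧_; not; T)
open import Data.List using (List; []; _∷_; _++_; length; filterᵇ; allFin)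
open import Data.List.Membership.Propositional using (_∈_)
open import Data.List.Relation.Unary.Unique.Propositional using (Unique)
open import Data.Product using (Σ; ∃; _×_; _,_)
open import Data.Unit using (⊤)
open import Relation.Nullary using (¬_; does)
open import Relation.Binary.PropositionalEquality using (_≡_; _≢_)

record Graph (n : ℕ) : Set where
  field
    adj   : Fin n → Fin n → Bool
    sym   : ∀ x y → adj x y ≡ adj y x
    irref : ∀ x → adj x x ≡ false
open Graph public

Consec : {A : Set} → (A → A → Set) → List A → Set
Consec R [] = ⊤
Consec R (x ∷ []) = ⊤
Consec R (x ∷ y ∷ xs) = R x y × Consec R (y ∷ xs)

HamPath : {n : ℕ} → Graph n → Fin n → Fin n → Set
HamPath {n} G u v =
  Σ (List (Fin n)) λ p →
    (Σ (List (Fin n)) λ mid → p ≡ u ∷ (mid ++ (v ∷ [])))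
    × Unique p
    × (∀ w → w ∈ p)
    × Consec (λ x y → T (adj G x y)) p

HamConnected : {n : ℕ} → Graph n → Set
HamConnected {n} G = ∀ (u v : Fin n) → u ≢ v → HamPath G u v

eqᵇ : {n : ℕ} → Fin n → Fin n → Bool
eqᵇ x y = does (x ≟ y)

removeEdge : {n : ℕ} → Graph n → Fin n → Fin n → Graph n
removeEdge {n} G a b = record
  { adj = λ x y → adj G x y ∧ not ((eqᵇ x a ∧ eqᵇ y b) Data.Bool.∨ (eqᵇ x b ∧ eqᵇ y a))
  ; sym = symP
  ; irref = λ x → irrP x
  }
  where
  open import Data.Bool using (_∨_)
  open import Data.Bool.Properties using (∨-comm)
  open import Relation.Binary.PropositionalEquality using (cong₂; cong)
  symP : ∀ x y → (adj G x y ∧ not ((eqᵇ x a ∧ eqᵇ y b) ∨ (eqᵇ x b ∧ eqᵇ y a)))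
                ≡ (adj G y x ∧ not ((eqᵇ y a ∧ eqᵇ x b) ∨ (eqᵇ y b ∧ eqᵇ x a)))
  symP x y rewrite sym G x y
                 | Data.Bool.Properties.∧-comm (eqᵇ x a) (eqᵇ y b)
                 | Data.Bool.Properties.∧-comm (eqᵇ x b) (eqᵇ y a)
                 | ∨-comm (eqᵇ y b ∧ eqᵇ x a) (eqᵇ y a ∧ eqᵇ x b) = Relation.Binary.PropositionalEquality.refl
    where import Data.Bool.Properties
          import Relation.Binary.PropositionalEquality
  irrP : ∀ x → (adj G x x ∧ not ((eqᵇ x a ∧ eqᵇ x b) ∨ (eqᵇ x b ∧ eqᵇ x a))) ≡ false
  irrP x rewrite irref G x = Relation.Binary.PropositionalEquality.refl
    where import Relation.Binary.PropositionalEquality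

MinHamConnected : {n : ℕ} → Graph n → Set
MinHamConnected {n} G =
  HamConnected G × (∀ (a b : Fin n) → T (adj G a b) → ¬ HamConnected (removeEdge G a b))

degree : {n : ℕ} → Graph n → Fin n → ℕ
degree {n} G v = length (filterᵇ (adj G v) (allFin n))

MaxDegree : {n : ℕ} → Graph n → ℕ → Set
MaxDegree {n} G Δ = (∀ v → degree G v ≤ Δ) × (∃ λ v → degree G v ≡ Δ)

{-# OPTIONS --safe #-}

-- Necessity.  In a hamiltonian-connected graph of order at least 4 all degrees are at least 3, so
-- Δ = 3 means cubic and handshaking makes n even.  Let v have degree n - 2 and let u be its only
-- non-neighbour.  A Hamiltonian path from u to v contains a neighbour x of u that is neither the
-- second nor the last but one vertex; besides u and v it has two further neighbours, before and after
-- it on the path.  The spoke v–x can then be avoided: in a Hamiltonian path … v x …, v is adjacent to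
-- every vertex but u, so a neighbour c of x allows a rotation unless c is the first vertex, the
-- successor of x, or the successor of u.  Three neighbours block all rotations only for paths
-- p p⁺ … v x u z …, with p, u, z adjacent to x; then x and u may be exchanged and u rotated
-- instead, which fails only if p and z are adjacent to u and p⁺ is not.  The same argument for p and its
-- neighbours u, x, p⁺ would make p⁺ adjacent to u.
--
-- Sufficiency.  A gadget X is a graph with three terminals and enough Hamiltonian paths ending at
-- terminals.  Joining two of them to the ends of a path on Δ - 1 vertices, and the third one and the whole
-- path to a hub, gives a hamiltonian-connected graph of order Δ + |X|.  Gadgets are stable under adding
-- a rung (two adjacent vertices, in front of the two sides), which adds 2 to |X|; starting from
-- one vertex or from K₄ minus an edge, all orders except 0 and 2 are reached.  The graph is minimal
-- because every edge has an end of degree 3.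
module Submission where

open import Defs
open import Data.Bool using (Bool; true; false; T; not; _∧_; _∨_; _xor_; if_then_else_)
import Data.Bool.Properties as Boolₚ
open import Data.Bool.Properties using (T?; T-∧; T-∨; xor-comm; xor-same)
open import Data.Empty using (⊥; ⊥-elim)
open import Data.Fin using (Fin; zero; suc; _≟_; fromℕ; inject₁)
open import Data.Fin.Patterns using (0F; 1F; 2F; 3F)
open import Data.Fin.Properties using (any?; all?)
open import Data.Fin.Relation.Unary.Top using (view; ‵fromℕ; ‵inject₁; view-fromℕ; view-inject₁)
open import Data.List
  using (List; []; _∷_; _++_; [_]; length; filterᵇ; allFin; tabulate; lookup; reverse; map)
import Data.List.Membership.DecPropositional as DecMembership
open import Data.List.Membership.Propositional using (_∈_; _∉_)
open import Data.List.Membership.Propositional.Properties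
  using (∈-∃++; ∈-++⁻; ∈-++⁺ˡ; ∈-++⁺ʳ; ∈-filter⁺; ∈-filter⁻; ∈-allFin; ∈-insert; ∈-map⁺; ∈-map⁻)
open import Data.List.Membership.Propositional.Properties.WithK using (unique∧set⇒bag)
open import Data.List.Properties
  using (unfold-reverse; reverse-++; length-++; length-map; length-tabulate; ++-assoc; map-++;
         map-tabulate; ∷-injective; ∷-injectiveˡ)
open import Data.List.Relation.Binary.BagAndSetEquality using (∼bag⇒↭)
open import Data.List.Relation.Binary.Permutation.Propositional
  using (_↭_; ↭-refl; ↭-sym; ↭-trans; ↭-prep; ↭-swap; ↭-reflexive; ↭⇒↭ₛ)
open import Data.List.Relation.Binary.Permutation.Propositional.Properties
  using (∈-resp-↭; ↭-reverse; ↭-length; shift; ++-comm;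
         ++-commutativeMonoid) renaming (++⁺ to ↭-++⁺; map⁺ to ↭-map⁺)
import Data.List.Relation.Binary.Permutation.Setoid.Properties as SetoidPerm
open import Data.List.Relation.Unary.All using ([]; _∷_)
open import Data.List.Relation.Unary.All.Properties using (All¬⇒¬Any; ¬Any⇒All¬)
open import Data.List.Relation.Unary.AllPairs using ([]; _∷_; head)
open import Data.List.Relation.Unary.Any using (here; there; index)
open import Data.List.Relation.Unary.Any.Properties using (¬Any[]; lookup-index)
import Data.List.Relation.Unary.Unique.DecPropositional as DecUnique
open import Data.List.Relation.Unary.Unique.Propositional using (Unique)
open import Data.List.Relation.Unary.Unique.Propositional.Properties
  using (allFin⁺; filter⁺; ++⁺) renaming (map⁺ to Unique-map⁺)
open import Data.Nat using (ℕ; zero; suc; _+_; _*_; _∸_; _≤_; _<_; z≤n; s≤s)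
open import Data.Nat.Divisibility using (_∣_; _∣?_; _∣0; m∣m*n; n∣m*n; ∣m∣n⇒∣m+n; ∣m+n∣m⇒∣n)
import Data.Nat.Properties as ℕₚ
open import Algebra.Properties.CommutativeMonoid.Sum ℕₚ.+-0-commutativeMonoid
  using (sum; sum-cong-≗; ∑-distrib-+)
open import Data.Product using (Σ; ∃; ∃₂; _×_; _,_; proj₁; proj₂)
open import Data.Sum as Sum using (_⊎_; inj₁; inj₂)
import Data.Sum.Properties as Sumₚ
open import Data.Unit using (tt)
import Data.Unit.Properties as Unitₚ
open import Function using (_∘_; case_of_; mk⇔)
open import Function.Bundles using (_⇔_; Equivalence)
open import Relation.Binary using (DecidableEquality)
open import Relation.Binary.PropositionalEquality
  using (_≡_; _≢_; refl; cong; cong₂; subst; subst₂; ≢-sym; setoid) renaming (sym to ≡-sym; trans to ≡-trans)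
open import Relation.Nullary using (¬_; yes; no; Dec; does)
open import Relation.Nullary.Decidable
  using (_×-dec_; _⊎-dec_; _→-dec_; ¬?; decidable-stable; toWitness; toWitnessFalse; True)

private variable
  A B : Set
  R S : A → A → Set
  a b c d x y : A
  xs ys L M N : List A

Unique-resp-↭ : xs ↭ ys → Unique xs → Unique ys
Unique-resp-↭ p = SetoidPerm.Unique-resp-↭ (setoid _) (↭⇒↭ₛ p)

-- Walks and Hamiltonian paths

-- Both ends are indices of the type, so joining two walks asks only for the connecting edge.
data Walk (R : A → A → Set) : A → List A → A → Set where
  stop : ∀ a → Walk R a (a ∷ []) a
  _∷_  : R a b → Walk R b xs c → Walk R a (a ∷ xs) c

join : Walk R a xs b → R b c → Walk R c ys d → Walk R a (xs ++ ys) d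
join (stop _) r w = r ∷ w
join (s ∷ v)  r w = s ∷ join v r w

mapWalk : (f : A → B) → (∀ {x y} → R x y → S (f x) (f y)) →
          Walk R a xs b → Walk S (f a) (map f xs) (f b)
mapWalk f h (stop a) = stop (f a)
mapWalk f h (r ∷ w)  = h r ∷ mapWalk f h w

reverseWalk : (∀ {x y} → R x y → R y x) → Walk R a xs b → Walk R b (reverse xs) a
reverseWalk R-sym (stop a) = stop a
reverseWalk R-sym (_∷_ {a = a} {xs = xs} r w) =
  subst (λ l → Walk _ _ l _) (≡-sym (unfold-reverse a xs))
        (join (reverseWalk R-sym w) (R-sym r) (stop a))

first∈ : Walk R a xs b → a ∈ xs
first∈ (stop _) = here refl
first∈ (_ ∷ _)  = here refl

last∈ : Walk R a xs b → b ∈ xs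
last∈ (stop _) = here refl
last∈ (_ ∷ w)  = there (last∈ w)

head≡ : Walk R a (x ∷ xs) b → x ≡ a
head≡ (stop _) = refl
head≡ (_ ∷ _)  = refl

walk-cons : Walk R a xs b → ∃ λ ys → xs ≡ a ∷ ys
walk-cons (stop _) = [] , refl
walk-cons (_ ∷ _)  = _ , refl

unsnoc : Walk R a xs b → ∃ λ ys → xs ≡ ys ++ [ b ]
unsnoc (stop a) = [] , refl
unsnoc (_∷_ {a = a} r w) with unsnoc w
... | ys , refl = a ∷ ys , refl

cut : ∀ xs → Walk R a ((x ∷ xs) ++ y ∷ ys) b →
      ∃ λ c → Walk R a (x ∷ xs) c × R c y × Walk R y (y ∷ ys) b
cut [] (r ∷ stop a)          = _ , stop _ , r , stop a
cut [] (r ∷ w@(_ ∷ _))       = _ , stop _ , r , w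
cut (z ∷ xs) (r ∷ w) with cut xs w
... | c , w₁ , s , w₂ = c , r ∷ w₁ , s , w₂

-- The visited vertices are recorded only up to permutation of `L`, so that cutting and rejoining
-- paths needs no bookkeeping of their order. When `L` enumerates all vertices once, this is a
-- Hamiltonian path.
record HP {A : Set} (R : A → A → Set) (L : List A) (a b : A) : Set where
  constructor hp
  field
    {list} : List A
    walk   : Walk R a list b
    perm   : list ↭ L

single : (a : A) → HP R [ a ] a a
single a = hp (stop a) ↭-refl

whole : Walk R a xs b → HP R xs a b
whole w = hp w ↭-refl

reorder : L ↭ M → HP R L a b → HP R M a b
reorder q (hp w p) = hp w (↭-trans p q)

_⟨_⟩_ : HP R L a b → R b c → HP R M c d → HP R (L ++ M) a d
hp w p ⟨ r ⟩ hp v q = hp (join w r v) (↭-++⁺ p q)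

infixr 5 _⟨_⟩_

reverseHP : (∀ {x y} → R x y → R y x) → HP R L a b → HP R L b a
reverseHP R-sym (hp {xs} w p) = hp (reverseWalk R-sym w) (↭-trans (↭-reverse xs) p)

-- Lists without repetition

Unique-++ˡ : ∀ xs {ys : List A} → Unique (xs ++ ys) → Unique xs
Unique-++ˡ []       u       = []
Unique-++ˡ (x ∷ xs) (p ∷ u) =
  ¬Any⇒All¬ xs (All¬⇒¬Any p ∘ ∈-++⁺ˡ) ∷ Unique-++ˡ xs u

Unique-++ʳ : ∀ xs {ys : List A} → Unique (xs ++ ys) → Unique ys
Unique-++ʳ []       u       = u
Unique-++ʳ (x ∷ xs) (_ ∷ u) = Unique-++ʳ xs u

Unique-disjoint : ∀ xs {ys : List A} → Unique (xs ++ ys) → a ∈ xs → b ∈ ys → a ≢ b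
Unique-disjoint (x ∷ xs) (p ∷ u) (here refl) b∈ refl = All¬⇒¬Any p (∈-++⁺ʳ xs b∈)
Unique-disjoint (x ∷ xs) (p ∷ u) (there a∈)  b∈ eq   = Unique-disjoint xs u a∈ b∈ eq

split-unique : ∀ xs xs′ {ys ys′ : List A} → Unique (xs ++ a ∷ ys) →
               xs ++ a ∷ ys ≡ xs′ ++ a ∷ ys′ → xs ≡ xs′ × ys ≡ ys′
split-unique []       []         u       refl = refl , refl
split-unique []       (_ ∷ xs′)  (p ∷ u) refl = ⊥-elim (All¬⇒¬Any p (∈-insert xs′))
split-unique (_ ∷ xs) []         (p ∷ u) refl = ⊥-elim (All¬⇒¬Any p (∈-insert xs))
split-unique (x ∷ xs) (x′ ∷ xs′) (p ∷ u) eq with ∷-injective eq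
... | refl , eq′ with split-unique xs xs′ u eq′
...   | refl , refl = refl , refl

length-⊆ : Unique xs → (∀ {x} → x ∈ xs → x ∈ ys) → length xs ≤ length ys
length-⊆ {xs = []}     u       sub = z≤n
length-⊆ {xs = x ∷ xs} (p ∷ u) sub with ∈-∃++ (sub (here refl))
... | as , bs , refl = subst (suc (length xs) ≤_) (≡-sym len) (s≤s (length-⊆ u sub′))
  where
  len : length (as ++ x ∷ bs) ≡ suc (length (as ++ bs))
  len rewrite length-++ as {x ∷ bs} | length-++ as {bs} = ℕₚ.+-suc (length as) (length bs)
  sub′ : ∀ {z} → z ∈ xs → z ∈ as ++ bs
  sub′ z∈ with ∈-++⁻ as (sub (there z∈))
  ... | inj₁ q           = ∈-++⁺ˡ q
  ... | inj₂ (here refl) = ⊥-elim (All¬⇒¬Any p z∈)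
  ... | inj₂ (there q)   = ∈-++⁺ʳ as q

-- Degrees

module _ {n : ℕ} (G : Graph n) where

  Adj : Fin n → Fin n → Set
  Adj x y = T (adj G x y)

  Adj-sym : ∀ {x y} → Adj x y → Adj y x
  Adj-sym {x} {y} = subst T (Graph.sym G x y)

  Adj⇒≢ : ∀ {x y} → Adj x y → x ≢ y
  Adj⇒≢ {x} r refl = subst T (irref G x) r

  neighbours : Fin n → List (Fin n)
  neighbours v = filterᵇ (adj G v) (allFin n)

  neighbours! : ∀ v → Unique (neighbours v)
  neighbours! v = filter⁺ (T? ∘ adj G v) (allFin⁺ n)

  ∈-neighbours⁺ : ∀ {v w} → Adj v w → w ∈ neighbours v
  ∈-neighbours⁺ {v} {w} r = ∈-filter⁺ (T? ∘ adj G v) (∈-allFin w) r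

  ∈-neighbours⁻ : ∀ {v w} → w ∈ neighbours v → Adj v w
  ∈-neighbours⁻ {v} p = proj₂ (∈-filter⁻ (T? ∘ adj G v) {xs = allFin n} p)

  degree-≤ : ∀ {v l} → (∀ {w} → Adj v w → w ∈ l) → degree G v ≤ length l
  degree-≤ {v} h = length-⊆ (neighbours! v) (h ∘ ∈-neighbours⁻)

  degree-≥ : ∀ {v l} → Unique l → (∀ {w} → w ∈ l → Adj v w) → length l ≤ degree G v
  degree-≥ u h = length-⊆ u (∈-neighbours⁺ ∘ h)

  HamWalk : Fin n → Fin n → Set
  HamWalk a b = Σ (List (Fin n)) λ P → Walk Adj a P b × Unique P × (∀ w → w ∈ P)

  toHamPath : ∀ {a b} → a ≢ b → HamWalk a b → HamPath G a b
  toHamPath a≢b (P , w , u , full) = P , ends a≢b w , u , full , consec w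
    where
    ends : ∀ {a b P} → a ≢ b → Walk Adj a P b → Σ (List (Fin n)) λ mid → P ≡ a ∷ (mid ++ [ b ])
    ends a≢b (stop a) = ⊥-elim (a≢b refl)
    ends a≢b (r ∷ w) with unsnoc w
    ... | mid , refl = mid , refl
    consec : ∀ {a b P} → Walk Adj a P b → Consec Adj P
    consec (stop a)        = tt
    consec (r ∷ stop _)    = r , tt
    consec (r ∷ w@(_ ∷ _)) = r , consec w

  fromHamPath : ∀ {a b} → HamPath G a b → HamWalk a b
  fromHamPath {a} {b} (P , (mid , refl) , u , full , c) = P , walk a mid c , u , full
    where
    walk : ∀ a mid → Consec Adj (a ∷ (mid ++ [ b ])) → Walk Adj a (a ∷ (mid ++ [ b ])) b
    walk a []        (r , _) = r ∷ stop b
    walk a (m ∷ mid) (r , c) = r ∷ walk m mid c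

length-full : ∀ {n} {P : List (Fin n)} → Unique P → length P ≤ n
length-full {n} {P} u = subst (length P ≤_) (length-tabulate {n = n} (λ i → i)) (length-⊆ u (λ {x} _ → ∈-allFin x))

full-length : ∀ {n} {P : List (Fin n)} → (∀ w → w ∈ P) → n ≤ length P
full-length {n} {P} full = subst (_≤ length P) (length-tabulate {n = n} (λ i → i)) (length-⊆ (allFin⁺ n) (λ {x} _ → full x))

module _ {n : ℕ} where
  open import Data.List.Membership.DecPropositional (_≟_ {n}) using (_∈?_)

  fresh : (l : List (Fin n)) → length l < n → ∃ λ w → w ∉ l
  fresh l l<n with any? (λ w → ¬? (w ∈? l))
  ... | yes p = p
  ... | no ¬p = ⊥-elim (ℕₚ.<⇒≱ l<n (full-length λ w → decidable-stable (w ∈? l) (λ q → ¬p (w , q))))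

-- The minimum degree of a hamiltonian-connected graph

interior : Walk R a L b → x ∈ L → x ≢ a → x ≢ b →
           ∃₂ λ xs c → ∃₂ λ d ys → L ≡ xs ++ x ∷ ys
             × Walk R a xs c × R c x × R x d × Walk R d ys b
interior w x∈ x≢a x≢b with ∈-∃++ x∈
... | [] , ys , refl = ⊥-elim (x≢a (head≡ w))
... | (y ∷ xs) , ys , refl with cut xs w
...   | c , w₁ , r , stop _   = ⊥-elim (x≢b refl)
...   | c , w₁ , r , (s ∷ w₂) = y ∷ xs , c , _ , ys , refl , w₁ , r , s , w₂

loop : Unique L → Walk R a L a → L ≡ [ a ]
loop u       (stop _) = refl
loop (p ∷ u) (r ∷ w)  = ⊥-elim (All¬⇒¬Any p (last∈ w))

module _ {n : ℕ} (G : Graph n) (4≤n : 4 ≤ n) (hc : HamConnected G) where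

  private
    -- A Hamiltonian path between two vertices other than v passes through v, so v has two distinct
    -- neighbours c and d, and no others. A Hamiltonian path from c to d enters and leaves v by c
    -- and d, hence is c v d, and the order would be 3.
    two-neighbours : ∀ {v p q} → (∀ {w} → Adj G v w → w ≡ p ⊎ w ≡ q) → ⊥
    two-neighbours {v} {p} {q} h
      with fresh [ v ] (ℕₚ.<-≤-trans (s≤s (s≤s z≤n)) 4≤n)
    ... | a , a∉ with fresh (v ∷ a ∷ []) (ℕₚ.<-≤-trans (s≤s (s≤s (s≤s z≤n))) 4≤n)
    ...   | b , b∉ with fromHamPath G (hc a b (λ { refl → b∉ (there (here refl)) }))
    ...     | P , w , u , full
      with interior w (full v) (λ { refl → a∉ (here refl) }) (λ { refl → b∉ (here refl) })
    ...       | xs , c , d , ys , refl , w₁ , cv , vd , w₂ = contra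
      where
      c≢d : c ≢ d
      c≢d = Unique-disjoint xs u (last∈ w₁) (there (first∈ w₂))
      only : ∀ {w} → Adj G v w → w ≡ c ⊎ w ≡ d
      only r with h r | h (Adj-sym G cv) | h vd
      ... | inj₁ e | inj₁ f | _      = inj₁ (≡-trans e (≡-sym f))
      ... | inj₂ e | inj₂ f | _      = inj₁ (≡-trans e (≡-sym f))
      ... | inj₁ e | inj₂ f | inj₁ g = inj₂ (≡-trans e (≡-sym g))
      ... | inj₂ e | inj₁ f | inj₂ g = inj₂ (≡-trans e (≡-sym g))
      ... | inj₁ e | inj₂ f | inj₂ g = ⊥-elim (c≢d (≡-trans f (≡-sym g)))
      ... | inj₂ e | inj₁ f | inj₁ g = ⊥-elim (c≢d (≡-trans f (≡-sym g)))
      contra : ⊥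
      contra with fromHamPath G (hc c d c≢d)
      ... | P , w , u , full
        with interior w (full v) (≢-sym (Adj⇒≢ G cv)) (Adj⇒≢ G vd)
      ...   | xs , s , t , ys , refl , w₁ , sv , vt , w₂
        with only (Adj-sym G sv) | only vt
      ...     | inj₂ refl | _         = Unique-disjoint xs u (last∈ w₁) (there (last∈ w₂)) refl
      ...     | inj₁ refl | inj₁ refl = Unique-disjoint xs u (first∈ w₁) (there (first∈ w₂)) refl
      ...     | inj₁ refl | inj₂ refl
        with loop (Unique-++ˡ xs u) w₁ | Unique-++ʳ xs u
      ...       | refl | _ ∷ u₂ with loop u₂ w₂
      ...         | refl = ℕₚ.<⇒≱ 4≤n (full-length full)

  -- Stated for any list covering the neighbours, so that it applies both to `neighbours` and to a
  -- neighbour list from which one entry has been deleted, as in `critical`.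
  three-neighbours : ∀ {v} l → (∀ {w} → Adj G v w → w ∈ l) → 3 ≤ length l
  three-neighbours {v} []           h = ⊥-elim (two-neighbours {v} {v} {v} (λ r → ⊥-elim (¬Any[] (h r))))
  three-neighbours (p ∷ [])         h = ⊥-elim (two-neighbours {q = p} (λ r → case h r of λ { (here e) → inj₁ e }))
  three-neighbours (p ∷ q ∷ [])     h =
    ⊥-elim (two-neighbours (λ r → case h r of λ { (here e) → inj₁ e ; (there (here e)) → inj₂ e }))
  three-neighbours (_ ∷ _ ∷ _ ∷ _)  h = s≤s (s≤s (s≤s z≤n))

-- Handshaking

indicator : Bool → ℕ
indicator b = if b then 1 else 0

length-filterᵇ : ∀ {n} (f : A → Bool) (g : Fin n → A) →
                 length (filterᵇ f (tabulate g)) ≡ sum (λ i → indicator (f (g i)))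
length-filterᵇ {n = zero}  f g = refl
length-filterᵇ {n = suc n} f g with f (g zero)
... | true  = cong suc (length-filterᵇ f (g ∘ suc))
... | false = length-filterᵇ f (g ∘ suc)

-- Row 0 and column 0 have equal sums by symmetry and meet in a zero, so peeling them off removes
-- twice a row sum.
symmetric-sum-even : ∀ {n} (f : Fin n → Fin n → ℕ) → (∀ i j → f i j ≡ f j i) →
                     (∀ i → f i i ≡ 0) → 2 ∣ sum (λ i → sum (f i))
symmetric-sum-even {zero}  f f-sym f-diag = 2 ∣0
symmetric-sum-even {suc n} f f-sym f-diag = subst (2 ∣_) (≡-sym eq)
  (∣m∣n⇒∣m+n (m∣m*n row)
     (symmetric-sum-even (λ i j → f (suc i) (suc j)) (λ i j → f-sym (suc i) (suc j)) (f-diag ∘ suc)))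
  where
  row = sum (λ j → f zero (suc j))
  rest = sum (λ i → sum (λ j → f (suc i) (suc j)))
  eq : sum (λ i → sum (f i)) ≡ 2 * row + rest
  eq rewrite f-diag zero
           | ∑-distrib-+ (λ i → f (suc i) zero) (λ i → sum (λ j → f (suc i) (suc j)))
           | sum-cong-≗ (λ i → f-sym (suc i) zero)
           | ℕₚ.+-identityʳ row = ≡-sym (ℕₚ.+-assoc row row rest)

degree-sum-even : ∀ {n} (G : Graph n) → 2 ∣ sum (degree G)
degree-sum-even {n} G = subst (2 ∣_) (sum-cong-≗ (λ v → ≡-sym (length-filterᵇ (adj G v) (λ i → i))))
  (symmetric-sum-even (λ v w → indicator (adj G v w))
     (λ v w → cong indicator (Graph.sym G v w)) (λ v → cong indicator (irref G v)))

-- The even degree sum 3n is written as 2n + n, so that evenness passes to n.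
cubic⇒even-order : ∀ {n} (G : Graph n) → (∀ v → degree G v ≡ 3) → 2 ∣ n
cubic⇒even-order {n} G h = ∣m+n∣m⇒∣n (subst (2 ∣_) eq (degree-sum-even G)) (n∣m*n n)
  where
  const-sum : ∀ k → sum {k} (λ _ → 3) ≡ k * 2 + k
  const-sum zero    = refl
  const-sum (suc k) rewrite const-sum k = cong (2 +_) (≡-sym (ℕₚ.+-suc (k * 2) k))
  eq : sum (degree G) ≡ n * 2 + n
  eq = ≡-trans (sum-cong-≗ h) (const-sum n)

-- Up to permutation, lists form a commutative monoid under concatenation. Rearranging the blocks of
-- a path is thus left to a monoid solver.
module PermutationSolver {A : Set} where
  open import Algebra.Solver.CommutativeMonoid (++-commutativeMonoid {A = A}) public
    using (solve; _⊕_; _⊜_)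
open PermutationSolver

-- Consecutive entries of a list

Succ : List A → A → A → Set
Succ P d c = ∃₂ λ xs ys → P ≡ xs ++ d ∷ c ∷ ys

Succ-++ˡ : Succ xs d c → Succ (xs ++ ys) d c
Succ-++ˡ {ys = ys} (as , bs , refl) = as , bs ++ ys , ++-assoc as _ ys

Succ-++ʳ : ∀ xs → Succ ys d c → Succ (xs ++ ys) d c
Succ-++ʳ xs (as , bs , refl) = xs ++ as , bs , ≡-sym (++-assoc xs as _)

-- Without repetition d occurs at one place only, so what follows it there starts with c. The prefix
-- comes in two pieces to match paths written as A followed by v and x without reassociating.
Succ-tail : ∀ xs ws → Unique (xs ++ ws ++ d ∷ ys) → Succ (xs ++ ws ++ d ∷ ys) d c → ∃ λ zs → ys ≡ c ∷ zs
Succ-tail {d = d} {ys = ys} xs ws u (as , bs , eq) =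
  bs , proj₂ (split-unique (xs ++ ws) as (subst Unique (≡-sym assoc) u) (≡-trans assoc eq))
  where assoc = ++-assoc xs ws (d ∷ ys)

Succ-functional : Unique L → Succ L d c → Succ L d x → c ≡ x
Succ-functional u (as , bs , refl) s with Succ-tail as [] u s
... | _ , refl = refl

Succ-reverse : Succ L d c → Succ (reverse L) c d
Succ-reverse {d = d} {c = c} (as , bs , refl) = reverse bs , reverse as ,
  ≡-trans (reverse-++ as (d ∷ c ∷ bs))
    (≡-trans (cong (_++ reverse as) (≡-trans (unfold-reverse d (c ∷ bs)) (cong (_++ [ d ]) (unfold-reverse c bs))))
      (≡-trans (++-assoc (reverse bs ++ [ c ]) [ d ] (reverse as)) (++-assoc (reverse bs) [ c ] (d ∷ reverse as))))

Succ-injective : Unique L → Succ L c d → Succ L x d → c ≡ x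
Succ-injective {L = L} u s t =
  Succ-functional (Unique-resp-↭ (↭-sym (↭-reverse L)) u) (Succ-reverse s) (Succ-reverse t)

walk-Succ : Walk R a xs c → Succ (xs ++ d ∷ ys) c d
walk-Succ {ys = ys} w with unsnoc w
... | zs , refl = zs , ys , ++-assoc zs _ _

Succ⇒≢ : Unique L → Succ L d c → d ≢ c
Succ⇒≢ u (as , bs , refl) refl = All¬⇒¬Any (head (Unique-++ʳ as u)) (here refl)

cut∈ : Walk R a L b → c ∈ L → c ≡ a ⊎ (∃ λ d → ∃₂ λ xs ys →
         Walk R a xs d × Walk R c ys b × L ≡ xs ++ ys × Succ L d c)
cut∈ w c∈ with ∈-∃++ c∈
... | []     , ys , refl = inj₁ (head≡ w)
... | x ∷ xs , ys , refl with cut xs w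
...   | d , w₁ , _ , w₂ with unsnoc w₁
...     | zs , eq = inj₂ (d , x ∷ xs , _ , w₁ , w₂ , refl ,
                          zs , ys , ≡-trans (cong (_++ _ ∷ ys) eq) (++-assoc zs _ _))

first-Succ : Walk R a xs b → Succ (x ∷ xs) x a
first-Succ w with walk-cons w
... | ys , refl = [] , ys , refl

-- Deleting an edge

module _ {n : ℕ} (G : Graph n) {v x : Fin n} where
  open Equivalence

  private
    eqᵇ⇒≡ : ∀ {s t : Fin n} → T (eqᵇ s t) → s ≡ t
    eqᵇ⇒≡ {s} {t} p with s ≟ t
    ... | yes e = e
    ... | no _  = ⊥-elim p

    ≡⇒eqᵇ : ∀ {s t : Fin n} → s ≡ t → T (eqᵇ s t)
    ≡⇒eqᵇ {s} refl with s ≟ s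
    ... | yes _ = tt
    ... | no ¬p = ¬p refl

    T-not⁺ : ∀ {b} → ¬ T b → T (not b)
    T-not⁺ {true}  h = h tt
    T-not⁺ {false} h = tt

    T-not⁻ : ∀ {b} → T (not b) → ¬ T b
    T-not⁻ {false} _ ()

  removeEdge⁺ : ∀ {s t} → Adj G s t → ¬ (s ≡ v × t ≡ x) → ¬ (s ≡ x × t ≡ v) →
                Adj (removeEdge G v x) s t
  removeEdge⁺ {s} {t} r h₁ h₂ = from T-∧ (r , T-not⁺ λ p → case to (T-∨ {eqᵇ s v ∧ eqᵇ t x}) p of λ where
    (inj₁ q) → case to (T-∧ {eqᵇ s v}) q of λ (e , f) → h₁ (eqᵇ⇒≡ e , eqᵇ⇒≡ f)
    (inj₂ q) → case to (T-∧ {eqᵇ s x}) q of λ (e , f) → h₂ (eqᵇ⇒≡ e , eqᵇ⇒≡ f))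

  -- Only the orientation from v to x is excluded; for the other one the edge is reversed first, as
  -- in `minimal`.
  removeEdge⁻ : ∀ {s t} → Adj (removeEdge G v x) s t → Adj G s t × ¬ (s ≡ v × t ≡ x)
  removeEdge⁻ {s} {t} r with to (T-∧ {adj G s t}) r
  ... | r , h = r , λ (e , f) → T-not⁻ h (from T-∨ (inj₁ (from (T-∧ {eqᵇ s v}) (≡⇒eqᵇ e , ≡⇒eqᵇ f))))

  traverses : ∀ {a b P} → Walk (Adj G) a P b →
              Walk (Adj (removeEdge G v x)) a P b ⊎ Succ P v x ⊎ Succ P x v
  traverses (stop a) = inj₁ (stop a)
  traverses (_∷_ {a} {b} {xs = xs} r w) with a ≟ v ×-dec b ≟ x | a ≟ x ×-dec b ≟ v | traverses w
  ... | _ | _ | inj₂ (inj₁ s) = inj₂ (inj₁ (Succ-++ʳ [ a ] s))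
  ... | _ | _ | inj₂ (inj₂ s) = inj₂ (inj₂ (Succ-++ʳ [ a ] s))
  ... | no h₁ | no h₂ | inj₁ w′ = inj₁ (removeEdge⁺ r h₁ h₂ ∷ w′)
  ... | yes (refl , refl) | _ | inj₁ _ = inj₂ (inj₁ (first-Succ w))
  ... | no _ | yes (refl , refl) | inj₁ _ = inj₂ (inj₂ (first-Succ w))

  avoiding : ∀ {a b P} → v ∉ P → Walk (Adj G) a P b → Walk (Adj (removeEdge G v x)) a P b
  avoiding v∉ (stop a) = stop a
  avoiding v∉ (r ∷ w)  = removeEdge⁺ r (λ { (refl , _) → v∉ (here refl) })
                                       (λ { (_ , refl) → v∉ (there (first∈ w)) })
                         ∷ avoiding (v∉ ∘ there) w

-- Vertices of degree n - 2

module NearlyDominating {n : ℕ} (G : Graph n) (4≤n : 4 ≤ n) (min : MinHamConnected G)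
  (deg≤ : ∀ w → degree G w ≤ n ∸ 2) (v u : Fin n) (u≢v : u ≢ v) (v≁u : ¬ Adj G v u)
  (dom : ∀ {w} → w ≢ v → w ≢ u → Adj G v w) where

  private
    hc = proj₁ min

  -- Read off from a path p p⁺ … v x u z … on which no exchange avoids the spoke v–x; {c₁, c₂} = {p, z}.
  record Obstruction (x c₁ c₂ : Fin n) : Set where
    field
      c₁~u : Adj G c₁ u
      c₂~u : Adj G c₂ u
      {p p⁺} : Fin n
      p~x   : Adj G p x
      p~u   : Adj G p u
      p≢v   : p ≢ v
      p~p⁺  : Adj G p p⁺
      p⁺≢v  : p⁺ ≢ v
      p⁺≢u  : p⁺ ≢ u
      p⁺≁u  : ¬ Adj G p⁺ u

  third-neighbour : ∀ w s t → ∃ λ d → Adj G w d × d ≢ s × d ≢ t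
  third-neighbour w s t with any? (λ d → T? (adj G w d) ×-dec ¬? (d ≟ s) ×-dec ¬? (d ≟ t))
  ... | yes (d , r) = d , r
  ... | no none = case three-neighbours G 4≤n hc (s ∷ t ∷ []) (λ {d} r → here-or-there d r) of λ { (s≤s (s≤s ())) }
    where
    here-or-there : ∀ d → Adj G w d → d ∈ s ∷ t ∷ []
    here-or-there d r with d ≟ s | d ≟ t
    ... | yes refl | _        = here refl
    ... | no _     | yes refl = there (here refl)
    ... | no h₁    | no h₂    = ⊥-elim (none (d , r , h₁ , h₂))

  -- The path runs through the spoke from v to x; `rerouted` treats the opposite direction by
  -- reversing the path.
  module Reroute (x : Fin n) (x~u : Adj G x u) (x≢v : x ≢ v)
    (A B : List (Fin n)) {a b : Fin n}
    (walk : Walk (Adj G) a (A ++ v ∷ x ∷ B) b) (uniq : Unique (A ++ v ∷ x ∷ B))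
    (full : ∀ w → w ∈ A ++ v ∷ x ∷ B) where

    H = removeEdge G v x
    P = A ++ v ∷ x ∷ B

    H-sym : ∀ {s t} → Adj H s t → Adj H t s
    H-sym = Adj-sym H

    Goal : Set
    Goal = HP (Adj H) P a b

    x≢u : x ≢ u
    x≢u = Adj⇒≢ G x~u

    keep : ∀ {s t} → s ≢ v → t ≢ v → Adj G s t → Adj H s t
    keep s≢v t≢v r = removeEdge⁺ G r (s≢v ∘ proj₁) (t≢v ∘ proj₂)

    spoke : ∀ {w} → w ≢ v → w ≢ u → w ≢ x → Adj H v w
    spoke w≢v w≢u w≢x = removeEdge⁺ G (dom w≢v w≢u) (w≢x ∘ proj₂) (w≢v ∘ proj₂)

    uniqʳ : Unique (v ∷ x ∷ B)
    uniqʳ = Unique-++ʳ A uniq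

    A≢v : ∀ {c} → c ∈ A → c ≢ v
    A≢v c∈ = Unique-disjoint A uniq c∈ (here refl)

    A≢x : ∀ {c} → c ∈ A → c ≢ x
    A≢x c∈ = Unique-disjoint A uniq c∈ (there (here refl))

    xB≢v : ∀ {c} → c ∈ x ∷ B → c ≢ v
    xB≢v c∈ refl with uniqʳ
    ... | p ∷ _ = All¬⇒¬Any p c∈

    B≢x : ∀ {c} → c ∈ B → c ≢ x
    B≢x c∈ refl with uniqʳ
    ... | _ ∷ p ∷ _ = All¬⇒¬Any p c∈

    -- Walks are nonempty, so a path that starts at v itself needs a separate constructor. In the
    -- other one, w is the predecessor of v.
    data Front : List (Fin n) → Set where
      empty    : a ≡ v → Front []
      nonempty : ∀ {y ys w} → Walk (Adj H) a (y ∷ ys) w → Adj H w v → Front (y ∷ ys)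

    -- Neither half uses the spoke: the vertices on both sides differ from v, and the edge entering
    -- v from the front does not come from x.
    parts : ∀ A → (∀ {c} → c ∈ A → c ≢ v) → (∀ {c} → c ∈ A → c ≢ x) →
            Walk (Adj G) a (A ++ v ∷ x ∷ B) b → Front A × Walk (Adj H) x (x ∷ B) b
    parts [] _ _ (r ∷ w) with head≡ w
    ... | refl = empty refl , avoiding G (λ v∈ → xB≢v v∈ refl) w
    parts (y ∷ ys) ≢v ≢x w with cut ys w
    ... | c , w₁ , r , (_ ∷ w₂) with head≡ w₂
    ...   | refl = nonempty (avoiding G (λ v∈ → ≢v v∈ refl) w₁)
                     (removeEdge⁺ G r (≢v (last∈ w₁) ∘ proj₁) (≢x (last∈ w₁) ∘ proj₁))
                 , avoiding G (λ v∈ → xB≢v v∈ refl) w₂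

    front : Front A
    front = proj₁ (parts A A≢v A≢x walk)

    back : Walk (Adj H) x (x ∷ B) b
    back = proj₂ (parts A A≢v A≢x walk)

    front-walk : ∀ {A} → Front A → HP (Adj H) (A ++ [ v ]) a v
    front-walk (empty refl)   = single v
    front-walk (nonempty w r) = whole w ⟨ r ⟩ single v

    regroup : (A ++ [ v ]) ++ x ∷ B ↭ P
    regroup = ↭-reflexive (++-assoc A [ v ] (x ∷ B))

    -- … c⁻ c … w v becomes … c⁻ v w … c, where c⁻ ≠ u is needed for c⁻ v to be an edge.
    rotate-front : ∀ {A c} → Front A → c ∈ A → (∀ {c} → c ∈ A → c ≢ v) → (∀ {c} → c ∈ A → c ≢ x) →
      HP (Adj H) (A ++ [ v ]) a c ⊎ Succ A u c ⊎ (∃ λ A′ → A ≡ c ∷ A′)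
    rotate-front {A₀} (nonempty w r) c∈ ≢v ≢x with cut∈ w c∈
    ... | inj₁ refl = inj₂ (inj₂ (_ , cong (_∷ _) (head≡ w)))
    ... | inj₂ (d , xs , ys , w₁ , w₂ , eq , s) with d ≟ u
    ...   | yes refl = inj₂ (inj₁ s)
    ...   | no d≢u = inj₁ (reorder perm (whole w₁ ⟨ H-sym (spoke (≢v d∈) d≢u (≢x d∈)) ⟩
                            single v ⟨ H-sym r ⟩ reverseHP H-sym (whole w₂)))
      where
      d∈ = subst (d ∈_) (≡-sym eq) (∈-++⁺ˡ (last∈ w₁))
      perm : xs ++ v ∷ ys ↭ A₀ ++ [ v ]
      perm = ↭-trans (solve 3 (λ xs v ys → xs ⊕ (v ⊕ ys) ⊜ (xs ⊕ ys) ⊕ v) ↭-refl xs [ v ] ys)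
                     (↭-reflexive (cong (_++ [ v ]) (≡-sym eq)))

    -- If c lies before v, the front is rotated to end at c and continues with x. If c lies after x,
    -- then ... v x ... c⁻ c ... becomes ... v c⁻ ... x c ...; here v c⁻ is no edge when c⁻ is u,
    -- and is the spoke when c⁻ is x.
    classify : ∀ {c} → c ≢ v → Adj G x c →
               Goal ⊎ Succ P x c ⊎ Succ P u c ⊎ (∃ λ A′ → A ≡ c ∷ A′)
    classify {c} c≢v x~c with ∈-++⁻ A (full c)
    ... | inj₂ (here refl)         = ⊥-elim (c≢v refl)
    ... | inj₂ (there (here refl)) = ⊥-elim (Adj⇒≢ G x~c refl)
    ... | inj₁ c∈ with rotate-front front c∈ A≢v A≢x
    ...   | inj₁ h        = inj₁ (reorder regroup (h ⟨ keep c≢v x≢v (Adj-sym G x~c) ⟩ whole back))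
    ...   | inj₂ (inj₁ s) = inj₂ (inj₂ (inj₁ (Succ-++ˡ s)))
    ...   | inj₂ (inj₂ e) = inj₂ (inj₂ (inj₂ e))
    classify {c} c≢v x~c | inj₂ (there (there c∈)) with cut∈ back (there c∈)
    ... | inj₁ refl = ⊥-elim (Adj⇒≢ G x~c refl)
    ... | inj₂ (d , xs , ys , w₁ , w₂ , eq , s) with d ≟ u | d ≟ x
    ...   | yes refl | _        = inj₂ (inj₂ (inj₁ (Succ-++ʳ A (Succ-++ʳ [ v ] s))))
    ...   | no _     | yes refl = inj₂ (inj₁ (Succ-++ʳ A (Succ-++ʳ [ v ] s)))
    ...   | no d≢u   | no d≢x   = inj₁ (reorder perm
              (front-walk front ⟨ spoke (xB≢v d∈) d≢u d≢x ⟩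
               reverseHP H-sym (whole w₁) ⟨ keep x≢v c≢v x~c ⟩ whole w₂))
      where
      d∈ = subst (d ∈_) (≡-sym eq) (∈-++⁺ˡ (last∈ w₁))
      perm : (A ++ [ v ]) ++ (xs ++ ys) ↭ P
      perm = subst (λ l → (A ++ [ v ]) ++ l ↭ P) eq regroup

    after-x : ∀ {c} → Succ P x c → ∃ λ B′ → B ≡ c ∷ B′
    after-x = Succ-tail A [ v ] uniq

    -- u d … w v x y … becomes u x d … w v y ….
    front-starts-at-u : ∀ {c d} → (∃ λ A′ → A ≡ u ∷ A′) → Succ P x c → Succ P u d → Adj G x d → Goal
    front-starts-at-u (A′ , refl) sx su x~d
      with after-x sx | Succ-tail [] [] uniq su | front
    ... | B′ , refl | ys , eq | nonempty (stop _) r =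
            ⊥-elim (v≁u (Adj-sym G (proj₁ (removeEdge⁻ G r))))
    ... | B′ , refl | ys , eq | nonempty (r₁ ∷ w) r with walk-cons w | back
    ...   | _ , refl | r₂ ∷ w₂ with eq | head≡ w₂
    ...     | refl | refl = reorder perm
              (single u ⟨ keep u≢v x≢v (Adj-sym G x~u) ⟩ single x
                ⟨ keep x≢v (A≢v (there (first∈ w))) x~d ⟩ whole w ⟨ r ⟩ single v
                ⟨ spoke (xB≢v (there (here refl)))
                        (≢-sym (Unique-disjoint A uniq (here refl) (there (there (here refl)))))
                        (B≢x (here refl)) ⟩ whole w₂)
      where
      perm : u ∷ x ∷ A′ ++ v ∷ B ↭ u ∷ A′ ++ v ∷ x ∷ B
      perm = solve 5 (λ u x A v B → u ⊕ (x ⊕ (A ⊕ (v ⊕ B))) ⊜ u ⊕ (A ⊕ (v ⊕ (x ⊕ B)))) ↭-refl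
                   [ u ] [ x ] A′ [ v ] B

  -- The path reads p … v x u z ….
  module Exchange (x : Fin n) (x~u : Adj G x u) (x≢v : x ≢ v)
    (p : Fin n) (A′ : List (Fin n)) (z : Fin n) (B′ : List (Fin n)) {a b : Fin n}
    (walk : Walk (Adj G) a (p ∷ A′ ++ v ∷ x ∷ u ∷ z ∷ B′) b)
    (uniq : Unique (p ∷ A′ ++ v ∷ x ∷ u ∷ z ∷ B′))
    (full : ∀ w → w ∈ p ∷ A′ ++ v ∷ x ∷ u ∷ z ∷ B′)
    (x~p : Adj G x p) (x~z : Adj G x z) where

    open Reroute x x~u x≢v (p ∷ A′) (u ∷ z ∷ B′) walk uniq full

    As = p ∷ A′

    tail-walk : Walk (Adj H) z (z ∷ B′) b
    tail-walk with back
    ... | _ ∷ (_ ∷ w) with head≡ w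
    ...   | refl = w

    u~z : Adj G u z
    u~z with back
    ... | _ ∷ (r ∷ w) with head≡ w
    ...   | refl = proj₁ (removeEdge⁻ G r)

    z≢v : z ≢ v
    z≢v = xB≢v (there (there (here refl)))

    u∉A : u ∉ As
    u∉A u∈ = Unique-disjoint As uniq u∈ (there (there (here refl))) refl

    u∉tail : ∀ {c} → c ∈ z ∷ B′ → c ≢ u
    u∉tail c∈ refl with uniqʳ
    ... | _ ∷ _ ∷ p ∷ _ = All¬⇒¬Any p c∈

    -- … d⁻ d … w v x u z … becomes … d⁻ v w … d u x z ….
    u-neighbour-in-front : ∀ {d} → d ∈ As → Adj G u d → Goal ⊎ d ≡ p
    u-neighbour-in-front d∈ u~d with rotate-front front d∈ A≢v A≢x
    ... | inj₂ (inj₂ (_ , refl)) = inj₂ refl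
    ... | inj₂ (inj₁ (xs , ys , eq)) = ⊥-elim (u∉A (subst (u ∈_) (≡-sym eq) (∈-insert xs)))
    ... | inj₁ h = inj₁ (reorder perm (h ⟨ keep (A≢v d∈) u≢v (Adj-sym G u~d) ⟩ single u
                     ⟨ keep u≢v x≢v (Adj-sym G x~u) ⟩ single x ⟨ keep x≢v z≢v x~z ⟩ whole tail-walk))
      where
      perm : (As ++ [ v ]) ++ u ∷ x ∷ z ∷ B′ ↭ P
      perm = solve 5 (λ A v u x B → (A ⊕ v) ⊕ (u ⊕ (x ⊕ B)) ⊜ A ⊕ (v ⊕ (x ⊕ (u ⊕ B)))) ↭-refl
               As [ v ] [ u ] [ x ] (z ∷ B′)

    -- … v x u z … d⁻ d … becomes … v d⁻ … z x u d ….
    u-neighbour-in-tail : ∀ {d} → d ∈ B′ → d ≢ z → Adj G u d → Goal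
    u-neighbour-in-tail {d} d∈ d≢z u~d with cut∈ tail-walk (there d∈)
    ... | inj₁ e = ⊥-elim (d≢z e)
    ... | inj₂ (c , xs , ys , w₁ , w₂ , eq , s) = reorder perm
            (front-walk front ⟨ spoke (xB≢v (there (there c∈))) (u∉tail c∈) (B≢x (there c∈)) ⟩
             reverseHP H-sym (whole w₁) ⟨ keep z≢v x≢v (Adj-sym G x~z) ⟩ single x
             ⟨ keep x≢v u≢v x~u ⟩ single u
             ⟨ keep u≢v (xB≢v (there (there (there d∈)))) u~d ⟩ whole w₂)
      where
      c∈ : c ∈ z ∷ B′
      c∈ = subst (c ∈_) (≡-sym eq) (∈-++⁺ˡ (last∈ w₁))
      perm : (As ++ [ v ]) ++ xs ++ x ∷ u ∷ ys ↭ P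
      perm = ↭-trans (solve 6 (λ A v xs x u ys → (A ⊕ v) ⊕ (xs ⊕ (x ⊕ (u ⊕ ys))) ⊜
                                                  A ⊕ (v ⊕ (x ⊕ (u ⊕ (xs ⊕ ys))))) ↭-refl
                        As [ v ] xs [ x ] [ u ] ys)
               (↭-reflexive (cong (λ l → As ++ v ∷ x ∷ u ∷ l) (≡-sym eq)))

    p≢v : p ≢ v
    p≢v = A≢v (here refl)

    -- `stuck` rules out the one configuration that no exchange handles. `obstruction` supplies it
    -- from the absence of an `Obstruction`.
    module _ (stuck : Adj G p u → ∀ {p⁺} → Adj G p p⁺ → p⁺ ≢ v → p⁺ ≢ u → ¬ Adj G p⁺ u → ⊥) where

      u-adjacent-to-p : Adj G u p → Goal
      u-adjacent-to-p u~p = by-cases A′ B′ refl refl front tail-walk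
        where
        -- `A′` and `B′` are module parameters, so the case split is made on copies tied to them by
        -- equations.
        by-cases : ∀ A″ B″ → A″ ≡ A′ → B″ ≡ B′ → Front (p ∷ A″) → Walk (Adj H) z (z ∷ B″) b → Goal
        -- The graph would have the five vertices p, v, x, u, z, and x would be adjacent to all others.
        by-cases [] [] refl refl _ _ = ⊥-elim (ℕₚ.1+n≰n (ℕₚ.≤-trans six≤ (full-length full)))
          where
          four≤ : 4 ≤ n ∸ 2
          four≤ = ℕₚ.≤-trans (degree-≥ G {x} {p ∷ v ∷ u ∷ z ∷ []}
            (case uniq of λ { ((pv ∷ _ ∷ pu ∷ pz ∷ []) ∷ (_ ∷ vu ∷ vz ∷ []) ∷ _ ∷ r) →
               (pv ∷ pu ∷ pz ∷ []) ∷ (vu ∷ vz ∷ []) ∷ r })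
            (λ where (here refl) → x~p
                     (there (here refl)) → Adj-sym G (dom x≢v x≢u)
                     (there (there (here refl))) → x~u
                     (there (there (there (here refl)))) → x~z))
            (deg≤ x)
          six≤ : 6 ≤ n
          six≤ = subst (6 ≤_) (ℕₚ.m+[n∸m]≡n (ℕₚ.≤-trans (s≤s (s≤s z≤n)) 4≤n)) (s≤s (s≤s four≤))
        -- p v x u z z⁺ … becomes p x u z v z⁺ ….
        by-cases [] (z⁺ ∷ B″) refl refl (nonempty (stop _) p~v) (_ ∷ w) with head≡ w
        ... | refl = reorder perm (single p ⟨ keep p≢v x≢v (Adj-sym G x~p) ⟩ single x
                      ⟨ keep x≢v u≢v x~u ⟩ single u ⟨ keep u≢v z≢v u~z ⟩ single z
                      ⟨ H-sym (spoke z≢v (u∉tail (here refl)) (B≢x (there (here refl)))) ⟩ single v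
                      ⟨ spoke (xB≢v (there (there (there (here refl))))) (u∉tail (there (here refl)))
                              (B≢x (there (there (here refl)))) ⟩ whole w)
          where
          perm : p ∷ x ∷ u ∷ z ∷ v ∷ z⁺ ∷ B″ ↭ P
          perm = solve 6 (λ p x u z v B → p ⊕ (x ⊕ (u ⊕ (z ⊕ (v ⊕ B)))) ⊜ p ⊕ (v ⊕ (x ⊕ (u ⊕ (z ⊕ B))))) ↭-refl
                   [ p ] [ x ] [ u ] [ z ] [ v ] (z⁺ ∷ B″)
        by-cases (p⁺ ∷ A″) _ refl refl (nonempty (r ∷ w) _) _ with head≡ w | T? (adj G u p⁺)
        ... | refl | no ≁ = ⊥-elim (stuck (Adj-sym G u~p) (proj₁ (removeEdge⁻ G r)) (A≢v (there (here refl)))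
                              (λ { refl → u∉A (there (here refl)) }) (≁ ∘ Adj-sym G))
        -- As p⁺ is not the first vertex of the path, the exchange for a neighbour of u in the front
        -- succeeds with d = p⁺.
        ... | refl | yes u~p⁺ with u-neighbour-in-front (there (here refl)) u~p⁺
        ...   | inj₁ g    = g
        ...   | inj₂ refl = ⊥-elim (Adj⇒≢ H r refl)

      -- Besides x and z, u has a third neighbour d. Wherever d lies, one of the two exchanges
      -- applies, unless d is the first vertex p.
      exchange : Goal
      exchange with third-neighbour u x z
      ... | d , u~d , d≢x , d≢z with ∈-++⁻ As (full d)
      ...   | inj₂ (here refl)                         = ⊥-elim (v≁u (Adj-sym G u~d))
      ...   | inj₂ (there (here refl))                 = ⊥-elim (d≢x refl)
      ...   | inj₂ (there (there (here refl)))         = ⊥-elim (Adj⇒≢ G u~d refl)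
      ...   | inj₂ (there (there (there (here refl)))) = ⊥-elim (d≢z refl)
      ...   | inj₂ (there (there (there (there d∈))))  = u-neighbour-in-tail d∈ d≢z u~d
      ...   | inj₁ d∈ with u-neighbour-in-front d∈ u~d
      ...     | inj₁ g    = g
      ...     | inj₂ refl = u-adjacent-to-p u~d

  -- If no obstruction occurred, every Hamiltonian path could be rerouted around the spoke v-x,
  -- against minimality. The obstruction goes to a continuation because minimality only denies that
  -- all pairs of ends work and names no failing pair.
  obstruction : ∀ {x c₁ c₂} → Adj G x u → x ≢ v → Adj G x c₁ → Adj G x c₂ → c₁ ≢ v → c₂ ≢ v →
                c₁ ≢ u → c₂ ≢ u → c₁ ≢ c₂ → (Obstruction x c₁ c₂ → ⊥) → ⊥
  obstruction {x} {c₁} {c₂} x~u x≢v x~c₁ x~c₂ c₁≢v c₂≢v c₁≢u c₂≢u c₁≢c₂ none =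
    proj₂ min v x (dom x≢v (Adj⇒≢ G x~u)) λ a b a≢b → toHamPath H a≢b (rerouted a b a≢b)
    where
    H = removeEdge G v x

    reroute : ∀ {a b P} → Walk (Adj G) a P b → Unique P → (∀ w → w ∈ P) → Succ P v x → HP (Adj H) P a b
    reroute w uniq full (A , B , refl) = by-classes (classify u≢v x~u) (classify c₁≢v x~c₁) (classify c₂≢v x~c₂)
      where
      open Reroute x x~u x≢v A B w uniq full
      Class : Fin n → Set
      Class c = Goal ⊎ Succ P x c ⊎ Succ P u c ⊎ (∃ λ A′ → A ≡ c ∷ A′)

      stuck : ∀ {p z} → Adj G z u → Adj G x p → p ≢ v → (Adj G p u → Adj G z u → Adj G c₁ u × Adj G c₂ u) →
              Adj G p u → ∀ {p⁺} → Adj G p p⁺ → p⁺ ≢ v → p⁺ ≢ u → ¬ Adj G p⁺ u → ⊥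
      stuck z~u x~p p≢v f p~u p~p⁺ p⁺≢v p⁺≢u p⁺≁u with f p~u z~u
      ... | c₁~u , c₂~u = none record
        { c₁~u = c₁~u ; c₂~u = c₂~u ; p~x = Adj-sym G x~p ; p~u = p~u ; p≢v = p≢v
        ; p~p⁺ = p~p⁺ ; p⁺≢v = p⁺≢v ; p⁺≢u = p⁺≢u ; p⁺≁u = p⁺≁u }

      -- The last argument identifies p and z with c₁ and c₂, in either order.
      exchanged : ∀ {p z} → Succ P x u → Succ P u z → (∃ λ A′ → A ≡ p ∷ A′) → Adj G x p → Adj G x z →
                  (Adj G p u → Adj G z u → Adj G c₁ u × Adj G c₂ u) → Goal
      exchanged sx su (A′ , refl) x~p x~z f with after-x sx
      ... | _ , refl with Succ-tail A (v ∷ x ∷ []) uniq su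
      ...   | _ , refl = exchange (stuck (Adj-sym G u~z) x~p p≢v f)
        where open Exchange x x~u x≢v _ A′ _ _ w uniq full x~p x~z

      -- Each of u, c₁, c₂ is blocked as successor of x, successor of u, or first vertex, and each
      -- reason fits only one vertex. As u does not succeed itself, it either follows x, so that the
      -- path reads p ... v x u z ..., or is the first vertex.
      by-classes : Class u → Class c₁ → Class c₂ → Goal
      by-classes (inj₁ g) _ _ = g
      by-classes _ (inj₁ g) _ = g
      by-classes _ _ (inj₁ g) = g
      by-classes (inj₂ (inj₂ (inj₁ s))) _ _ = ⊥-elim (Succ⇒≢ uniq s refl)
      by-classes (inj₂ (inj₁ s)) (inj₂ (inj₁ s₁)) _ = ⊥-elim (c₁≢u (Succ-functional uniq s₁ s))
      by-classes (inj₂ (inj₁ s)) _ (inj₂ (inj₁ s₂)) = ⊥-elim (c₂≢u (Succ-functional uniq s₂ s))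
      by-classes (inj₂ (inj₁ s)) (inj₂ (inj₂ (inj₁ s₁))) (inj₂ (inj₂ (inj₁ s₂))) =
        ⊥-elim (c₁≢c₂ (Succ-functional uniq s₁ s₂))
      by-classes (inj₂ (inj₁ s)) (inj₂ (inj₂ (inj₁ s₁))) (inj₂ (inj₂ (inj₂ e))) =
        exchanged s s₁ e x~c₂ x~c₁ (λ p q → q , p)
      by-classes (inj₂ (inj₁ s)) (inj₂ (inj₂ (inj₂ e))) (inj₂ (inj₂ (inj₁ s₂))) =
        exchanged s s₂ e x~c₁ x~c₂ (λ p q → p , q)
      by-classes (inj₂ (inj₁ s)) (inj₂ (inj₂ (inj₂ (_ , e)))) (inj₂ (inj₂ (inj₂ (_ , e′)))) =
        ⊥-elim (c₁≢c₂ (∷-injectiveˡ (≡-trans (≡-sym e) e′)))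
      by-classes (inj₂ (inj₂ (inj₂ (_ , e)))) (inj₂ (inj₂ (inj₂ (_ , e′)))) _ =
        ⊥-elim (c₁≢u (∷-injectiveˡ (≡-trans (≡-sym e′) e)))
      by-classes (inj₂ (inj₂ (inj₂ (_ , e)))) _ (inj₂ (inj₂ (inj₂ (_ , e′)))) =
        ⊥-elim (c₂≢u (∷-injectiveˡ (≡-trans (≡-sym e′) e)))
      by-classes (inj₂ (inj₂ (inj₂ _))) (inj₂ (inj₁ s₁)) (inj₂ (inj₁ s₂)) =
        ⊥-elim (c₁≢c₂ (Succ-functional uniq s₁ s₂))
      by-classes (inj₂ (inj₂ (inj₂ _))) (inj₂ (inj₂ (inj₁ s₁))) (inj₂ (inj₂ (inj₁ s₂))) =
        ⊥-elim (c₁≢c₂ (Succ-functional uniq s₁ s₂))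
      by-classes (inj₂ (inj₂ (inj₂ e))) (inj₂ (inj₁ s₁)) (inj₂ (inj₂ (inj₁ s₂))) =
        front-starts-at-u e s₁ s₂ x~c₂
      by-classes (inj₂ (inj₂ (inj₂ e))) (inj₂ (inj₂ (inj₁ s₁))) (inj₂ (inj₁ s₂)) =
        front-starts-at-u e s₂ s₁ x~c₁

    finish : ∀ {a b P} → Unique P → (∀ w → w ∈ P) → HP (Adj H) P a b → HamWalk H a b
    finish uniq full (hp w p) = _ , w , Unique-resp-↭ (↭-sym p) uniq , (λ t → ∈-resp-↭ (↭-sym p) (full t))

    rerouted : ∀ a b → a ≢ b → HamWalk H a b
    rerouted a b a≢b with fromHamPath G (proj₁ min a b a≢b)
    ... | P , w , uniq , full with traverses G {v} {x} w
    ...   | inj₁ w′ = P , w′ , uniq , full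
    ...   | inj₂ (inj₁ s) = finish uniq full (reroute w uniq full s)
    ...   | inj₂ (inj₂ s) = finish uniq full (reorder (↭-reverse P) (reverseHP (Adj-sym H)
              (reroute (reverseWalk (Adj-sym G) w) (Unique-resp-↭ (↭-sym (↭-reverse P)) uniq)
                 (λ t → ∈-resp-↭ (↭-sym (↭-reverse P)) (full t)) (Succ-reverse s))))

  -- The obstruction at x yields p and p⁺, and the argument is repeated at p with the neighbours x
  -- and p⁺. These differ, since x is adjacent to u and p⁺ is not; but the second obstruction makes
  -- p⁺ adjacent to u.
  contradiction-at : ∀ {x c₁ c₂} → Adj G x u → x ≢ v → Adj G x c₁ → Adj G x c₂ → c₁ ≢ v → c₂ ≢ v →
                     c₁ ≢ u → c₂ ≢ u → c₁ ≢ c₂ → ⊥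
  contradiction-at x~u x≢v x~c₁ x~c₂ c₁≢v c₂≢v c₁≢u c₂≢u c₁≢c₂ =
    obstruction x~u x≢v x~c₁ x~c₂ c₁≢v c₂≢v c₁≢u c₂≢u c₁≢c₂ λ o → let open Obstruction o in
    obstruction p~u p≢v p~x p~p⁺ x≢v p⁺≢v (Adj⇒≢ G x~u) p⁺≢u (λ { refl → p⁺≁u x~u })
      λ o′ → p⁺≁u (Obstruction.c₂~u o′)

  impossible : ⊥
  impossible with fromHamPath G (hc u v u≢v)
  ... | _ , stop _ , _ = u≢v refl
  ... | _ , w@(_∷_ {b = s₁} _ w′) , uniq , full with cut∈ w (last∈ w)
  ...   | inj₁ v≡u = u≢v (≡-sym v≡u)
  ...   | inj₂ (sₖ , _ , _ , _ , _ , _ , sₖ-v) with third-neighbour u s₁ sₖ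
  ...     | d , u~d , d≢s₁ , d≢sₖ
    with interior w (full d) (≢-sym (Adj⇒≢ G u~d)) (λ { refl → v≁u (Adj-sym G u~d) })
  ...       | xs , c , e , ys , eq , w₁ , c~d , d~e , w₂ =
    -- The predecessor c of d is not u because d is not the second vertex s₁, and the successor e is
    -- not v because d is not the last but one, sₖ.
    contradiction-at (Adj-sym G u~d) (λ { refl → v≁u (Adj-sym G u~d) }) (Adj-sym G c~d) d~e
      (Unique-disjoint xs uniq′ (last∈ w₁) (there (last∈ w₂)))
      (λ { refl → d≢sₖ (Succ-injective uniq′ d-e (subst (λ l → Succ l sₖ v) eq sₖ-v)) })
      (λ { refl → d≢s₁ (Succ-functional uniq′ (walk-Succ w₁) (subst (λ l → Succ l u s₁) eq (first-Succ w′))) })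
      (≢-sym (Unique-disjoint xs uniq′ (first∈ w₁) (there (first∈ w₂))))
      (Unique-disjoint xs uniq′ (last∈ w₁) (there (first∈ w₂)))
    where
    uniq′ = subst Unique eq uniq
    d-e : Succ (xs ++ d ∷ ys) d e
    d-e = Succ-++ʳ xs (first-Succ w₂)

-- Restrictions on the maximum degree

module _ {n : ℕ} (G : Graph n) (4≤n : 4 ≤ n) where

  closed-neighbourhood! : ∀ v → Unique (v ∷ neighbours G v)
  closed-neighbourhood! v = ¬Any⇒All¬ _ (λ p → Adj⇒≢ G (∈-neighbours⁻ G p) refl) ∷ neighbours! G v

  degree<n : ∀ v → degree G v ≤ n ∸ 1
  degree<n v = ℕₚ.∸-monoˡ-≤ 1 (length-full (closed-neighbourhood! v))

  -- By counting, v has exactly one non-neighbour besides itself: with none, the n vertices would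
  -- fit into n - 1 places, and with two there would be n + 1 distinct vertices.
  degree≢n-2 : ∀ {v} → MinHamConnected G → (∀ w → degree G w ≤ n ∸ 2) → degree G v ≢ n ∸ 2
  degree≢n-2 {v} min deg≤ deg≡ with any? (λ u → ¬? (u ≟ v) ×-dec ¬? (T? (adj G v u)))
  ... | no none = ℕₚ.1+n≰n (subst (_≤ suc (n ∸ 2)) 2+n-2≡n (subst (λ k → n ≤ suc k) deg≡ (full-length full)))
    where
    2+n-2≡n : n ≡ suc (suc (n ∸ 2))
    2+n-2≡n = ≡-sym (ℕₚ.m+[n∸m]≡n (ℕₚ.≤-trans (s≤s (s≤s z≤n)) 4≤n))
    full : ∀ w → w ∈ v ∷ neighbours G v
    full w with w ≟ v
    ... | yes refl = here refl
    ... | no w≢v = there (∈-neighbours⁺ G (decidable-stable (T? _) (λ v≁w → none (w , w≢v , v≁w))))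
  ... | yes (u , u≢v , v≁u) = NearlyDominating.impossible G 4≤n min deg≤ v u u≢v v≁u dominated
    where
    dominated : ∀ {w} → w ≢ v → w ≢ u → Adj G v w
    dominated {w} w≢v w≢u = decidable-stable (T? _) λ v≁w →
      ℕₚ.1+n≰n (subst (λ k → suc k ≤ n) (≡-trans (cong (2 +_) deg≡) (ℕₚ.m+[n∸m]≡n (ℕₚ.≤-trans (s≤s (s≤s z≤n)) 4≤n)))
        (length-full {P = w ∷ u ∷ v ∷ neighbours G v}
          ((w≢u ∷ w≢v ∷ ¬Any⇒All¬ _ (v≁w ∘ ∈-neighbours⁻ G)) ∷
           (u≢v ∷ ¬Any⇒All¬ _ (v≁u ∘ ∈-neighbours⁻ G)) ∷ closed-neighbourhood! v)))

  degree-restrictions : ∀ {Δ} → MinHamConnected G → MaxDegree G Δ →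
                        3 ≤ Δ × Δ ≤ n ∸ 1 × Δ ≢ n ∸ 2 × (Δ ≡ 3 → 2 ∣ n)
  degree-restrictions min (deg≤ , v , refl) =
    3≤degree v , degree<n v ,
    (λ e → degree≢n-2 {v} min (λ w → subst (degree G w ≤_) e (deg≤ w)) e) ,
    λ e → cubic⇒even-order G (λ w → ℕₚ.≤-antisym (subst (degree G w ≤_) e (deg≤ w)) (3≤degree w))
    where
    3≤degree : ∀ w → 3 ≤ degree G w
    3≤degree w = three-neighbours G 4≤n (proj₁ min) (neighbours G w) (∈-neighbours⁺ G)

-- Spanning pairs of paths and gadgets

mapHP : (f : A → B) → (∀ {x y} → R x y → S (f x) (f y)) → HP R L a b → HP S (map f L) (f a) (f b)
mapHP f h (hp w p) = hp (mapWalk f h w) (↭-map⁺ f p)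

-- When `N` is free of repetition, `perm` forces the two paths to be disjoint.
record HP₂ {A : Set} (R : A → A → Set) (N : List A) (a b c d : A) : Set where
  constructor hp₂
  field
    {listˡ listʳ} : List A
    left  : HP R listˡ a b
    right : HP R listʳ c d
    perm  : listˡ ++ listʳ ↭ N

mapHP₂ : (f : A → B) → (∀ {x y} → R x y → S (f x) (f y)) → HP₂ R N a b c d → HP₂ S (map f N) (f a) (f b) (f c) (f d)
mapHP₂ {N = N} f h (hp₂ {L} {M} p q r) =
  hp₂ (mapHP f h p) (mapHP f h q) (↭-trans (↭-reflexive (≡-sym (map-++ f L M))) (↭-map⁺ f r))

swapHP₂ : HP₂ R N a b c d → HP₂ R N c d a b
swapHP₂ (hp₂ {L} {M} p q r) = hp₂ q p (↭-trans (++-comm M L) r)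

full-↭ : Unique L → Unique M → (∀ x → x ∈ L) → (∀ x → x ∈ M) → L ↭ M
full-↭ u v f g = ∼bag⇒↭ (unique∧set⇒bag u v (λ {x} → mk⇔ (λ _ → g x) (λ _ → f x)))

data Terminal : Set where
  side : Bool → Terminal
  tip  : Terminal

-- A Hamiltonian path from u can leave by at least two terminals. In the second case, the split
-- lets a pair of new vertices attached to the sides be inserted in a path that leaves by the tip.
data Exit {V : Set} (R : V → V → Set) (vs : List V) (t : Terminal → V) (u : V) : Set where
  both : (∀ b → HP R vs u (t (side b))) → Exit R vs t u
  turn : ∀ b → HP R vs u (t (side b)) → HP R vs u (t tip) →
         ∀ c → HP₂ R vs u (t (side c)) (t (side (not c))) (t tip) → Exit R vs t u

-- The two paths leave by different terminals, so that a path through the outside of the gadget can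
-- join them into one from u to v.
data Exits {V : Set} (R : V → V → Set) (vs : List V) (t : Terminal → V) (u v : V) : Set where
  sides : ∀ b → HP₂ R vs u (t (side b)) v (t (side (not b))) → Exits R vs t u v
  tipˡ  : ∀ b → HP₂ R vs u (t tip) v (t (side b)) → Exits R vs t u v
  tipʳ  : ∀ b → HP₂ R vs u (t (side b)) v (t tip) → Exits R vs t u v

swapExits : ∀ {V : Set} {R : V → V → Set} {vs t u v} → Exits R vs t u v → Exits R vs t v u
swapExits (sides true  h) = sides false (swapHP₂ h)
swapExits (sides false h) = sides true (swapHP₂ h)
swapExits (tipˡ b h)      = tipʳ b (swapHP₂ h)
swapExits (tipʳ b h)      = tipˡ b (swapHP₂ h)

-- A graph to be joined to an outside by one edge at each of its three terminals.
record Gadget : Set₁ where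
  field
    {V}      : Set
    _≟ⱽ_     : DecidableEquality V
    vs       : List V
    vs!      : Unique vs
    vs-full  : ∀ x → x ∈ vs
    edge     : V → V → Bool
    edge-sym : ∀ x y → edge x y ≡ edge y x
    edge-irr : ∀ x → edge x x ≡ false
    terminal : Terminal → V
  _~_ : V → V → Set
  x ~ y = T (edge x y)
  field
    across : ∀ b → HP _~_ vs (terminal (side b)) (terminal (side (not b)))
    to-tip : ∀ b → HP _~_ vs (terminal (side b)) (terminal tip)
    exit   : ∀ u → Exit _~_ vs terminal u
    exits  : ∀ {u v} → u ≢ v → Exits _~_ vs terminal u v
    -- An entry inj₂ i stands for the neighbour outside the gadget at terminal i.
    nb            : V → List (V ⊎ Terminal)
    nb-edge       : ∀ {x y} → x ~ y → inj₁ y ∈ nb x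
    nb-terminal   : ∀ i → inj₂ i ∈ nb (terminal i)
    cubic-edge    : ∀ {x y} → x ~ y → length (nb x) ≤ 3 ⊎ length (nb y) ≤ 3
    -- The tip will be joined to the hub, whose degree may be large, so it has to be the cubic end
    -- of that edge. The sides will be joined to rim vertices, which are cubic themselves.
    cubic-tip     : length (nb (terminal tip)) ≤ 3
    excess        : ℕ
    nb≤           : ∀ x → length (nb x) ≤ 3 + excess

-- Joined to a fan, this gadget gives a wheel.
point : Gadget
point = record
  { _≟ⱽ_ = Unitₚ._≟_ ; vs = [ tt ] ; vs! = [] ∷ [] ; vs-full = λ _ → here refl
  ; edge = λ _ _ → false ; edge-sym = λ _ _ → refl ; edge-irr = λ _ → refl
  ; terminal = λ _ → tt
  ; across = λ _ → single tt ; to-tip = λ _ → single tt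
  ; exit = λ _ → both λ _ → single tt ; exits = λ u≢v → ⊥-elim (u≢v refl)
  ; nb = λ _ → inj₂ (side true) ∷ inj₂ (side false) ∷ inj₂ tip ∷ []
  ; nb-edge = λ ()
  ; nb-terminal = λ where
      (side true)  → here refl
      (side false) → there (here refl)
      tip          → there (there (here refl))
  ; cubic-edge = λ () ; cubic-tip = ℕₚ.≤-refl
  ; excess = 0 ; nb≤ = λ _ → ℕₚ.≤-refl }

-- The gadget K₄ minus an edge

module Diamond where

  V = Fin 4

  edge : V → V → Bool
  edge 2F 3F = false
  edge 3F 2F = false
  edge x  y  = not (does (x ≟ y))

  _~_ : V → V → Set
  x ~ y = T (edge x y)

  -- The non-adjacent vertices `2F` and `3F` become cubic by their terminals; `0F` gets degree 4,
  -- whence `excess` is 1.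
  terminal : Terminal → V
  terminal (side true)  = 0F
  terminal (side false) = 2F
  terminal tip          = 3F

  nb : V → List (V ⊎ Terminal)
  nb 0F = inj₁ 1F ∷ inj₁ 2F ∷ inj₁ 3F ∷ inj₂ (side true) ∷ []
  nb 1F = inj₁ 0F ∷ inj₁ 2F ∷ inj₁ 3F ∷ []
  nb 2F = inj₁ 0F ∷ inj₁ 1F ∷ inj₂ (side false) ∷ []
  nb 3F = inj₁ 0F ∷ inj₁ 1F ∷ inj₂ tip ∷ []

  -- Edges and covering are decided by evaluation, so each path below is given by its vertices
  -- alone.
  steps : V → List V → Bool
  steps a []       = true
  steps a (b ∷ bs) = edge a b ∧ steps b bs

  end : V → List V → V
  end a []       = a
  end a (b ∷ bs) = end b bs

  walk-along : ∀ a bs → T (steps a bs) → Walk _~_ a (a ∷ bs) (end a bs)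
  walk-along a []       _  = stop a
  walk-along a (b ∷ bs) ok =
    let r , ok′ = Equivalence.to Boolₚ.T-∧ ok in r ∷ walk-along b bs ok′

  Full : List V → Set
  Full L = Unique L × (∀ x → x ∈ L)

  full? : ∀ L → Dec (Full L)
  full? L = DecUnique.unique? _≟_ L ×-dec all? (λ x → DecMembership._∈?_ _≟_ x L)

  arrange : ∀ L {ok : True (full? L)} → L ↭ allFin 4
  arrange L {ok} = let u , f = toWitness ok in full-↭ u (allFin⁺ 4) f ∈-allFin

  path : ∀ a bs {ok : T (steps a bs)} {full : True (full? (a ∷ bs))} → HP _~_ (allFin 4) a (end a bs)
  path a bs {ok} {full} = hp (walk-along a bs ok) (arrange _ {full})

  paths : ∀ a bs c ds {ok : T (steps a bs)} {ok′ : T (steps c ds)} {full : True (full? ((a ∷ bs) ++ (c ∷ ds)))} →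
          HP₂ _~_ (allFin 4) a (end a bs) c (end c ds)
  paths a bs c ds {ok} {ok′} {full} =
    hp₂ (whole (walk-along a bs ok)) (whole (walk-along c ds ok′)) (arrange _ {full})

  across : ∀ b → HP _~_ (allFin 4) (terminal (side b)) (terminal (side (not b)))
  across true  = path 0F (3F ∷ 1F ∷ 2F ∷ [])
  across false = path 2F (1F ∷ 3F ∷ 0F ∷ [])

  to-tip : ∀ b → HP _~_ (allFin 4) (terminal (side b)) (terminal tip)
  to-tip true  = path 0F (2F ∷ 1F ∷ 3F ∷ [])
  to-tip false = path 2F (0F ∷ 1F ∷ 3F ∷ [])

  exit : ∀ u → Exit _~_ (allFin 4) terminal u
  exit 0F = turn false (across true) (to-tip true) true (paths 0F [] 2F (1F ∷ 3F ∷ []))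
  exit 1F = turn false (path 1F (3F ∷ 0F ∷ 2F ∷ [])) (path 1F (2F ∷ 0F ∷ 3F ∷ [])) false
                 (paths 1F (2F ∷ []) 0F (3F ∷ []))
  exit 2F = turn true (across false) (to-tip false) false (paths 2F [] 0F (1F ∷ 3F ∷ []))
  exit 3F = both λ { true → path 3F (1F ∷ 2F ∷ 0F ∷ []) ; false → path 3F (1F ∷ 0F ∷ 2F ∷ []) }

  exits : ∀ {u v} → u ≢ v → Exits _~_ (allFin 4) terminal u v
  exits {0F} {0F} u≢v = ⊥-elim (u≢v refl)
  exits {0F} {1F} _   = tipˡ false (paths 0F (3F ∷ []) 1F (2F ∷ []))
  exits {0F} {2F} _   = tipʳ true (paths 0F [] 2F (1F ∷ 3F ∷ []))
  exits {0F} {3F} _   = sides true (paths 0F [] 3F (1F ∷ 2F ∷ []))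
  exits {1F} {1F} u≢v = ⊥-elim (u≢v refl)
  exits {1F} {2F} _   = tipˡ false (paths 1F (0F ∷ 3F ∷ []) 2F [])
  exits {1F} {3F} _   = tipʳ false (paths 1F (0F ∷ 2F ∷ []) 3F [])
  exits {2F} {2F} u≢v = ⊥-elim (u≢v refl)
  exits {2F} {3F} _   = sides false (paths 2F [] 3F (1F ∷ 0F ∷ []))
  exits {3F} {3F} u≢v = ⊥-elim (u≢v refl)
  exits {1F} {0F} u≢v = swapExits (exits (u≢v ∘ ≡-sym))
  exits {2F} {0F} u≢v = swapExits (exits (u≢v ∘ ≡-sym))
  exits {2F} {1F} u≢v = swapExits (exits (u≢v ∘ ≡-sym))
  exits {3F} {0F} u≢v = swapExits (exits (u≢v ∘ ≡-sym))
  exits {3F} {1F} u≢v = swapExits (exits (u≢v ∘ ≡-sym))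
  exits {3F} {2F} u≢v = swapExits (exits (u≢v ∘ ≡-sym))

  _≟ᵀ_ : DecidableEquality Terminal
  side b ≟ᵀ side c with b Boolₚ.≟ c
  ... | yes refl = yes refl
  ... | no b≢c   = no λ { refl → b≢c refl }
  side b ≟ᵀ tip    = no λ ()
  tip    ≟ᵀ side b = no λ ()
  tip    ≟ᵀ tip    = yes refl

  open DecMembership (Sumₚ.≡-dec (_≟_ {4}) _≟ᵀ_) using (_∈?_)

  gadget : Gadget
  gadget = record
    { _≟ⱽ_ = _≟_ ; vs = allFin 4 ; vs! = allFin⁺ 4 ; vs-full = ∈-allFin
    ; edge = edge
    ; edge-sym = toWitness {a? = all? λ x → all? λ y → edge x y Boolₚ.≟ edge y x} tt
    ; edge-irr = toWitness {a? = all? λ x → edge x x Boolₚ.≟ false} tt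
    ; terminal = terminal
    ; across = across ; to-tip = to-tip ; exit = exit ; exits = exits
    ; nb = nb
    ; nb-edge = λ {x} {y} →
        toWitness {a? = all? λ x → all? λ y → T? (edge x y) →-dec (inj₁ y ∈? nb x)} tt x y
    ; nb-terminal = λ where
        (side true)  → there (there (there (here refl)))
        (side false) → there (there (here refl))
        tip          → there (there (here refl))
    ; cubic-edge = λ {x} {y} →
        toWitness {a? = all? λ x → all? λ y → T? (edge x y) →-dec
                     ((length (nb x) ℕₚ.≤? 3) ⊎-dec (length (nb y) ℕₚ.≤? 3))} tt x y
    ; cubic-tip = ℕₚ.≤-refl
    ; excess = 1
    ; nb≤ = toWitness {a? = all? λ x → length (nb x) ℕₚ.≤? 4} tt }

-- Adding a rung to a gadget

module Rung (X : Gadget) where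

  open Gadget X

  V′ : Set
  V′ = V ⊎ Bool

  edge′ : V′ → V′ → Bool
  edge′ (inj₁ x) (inj₁ y) = edge x y
  edge′ (inj₁ x) (inj₂ b) = does (x ≟ⱽ terminal (side b))
  edge′ (inj₂ b) (inj₁ x) = does (x ≟ⱽ terminal (side b))
  edge′ (inj₂ b) (inj₂ c) = b xor c

  _~′_ : V′ → V′ → Set
  x ~′ y = T (edge′ x y)

  edge-sym′ : ∀ x y → edge′ x y ≡ edge′ y x
  edge-sym′ (inj₁ x) (inj₁ y) = edge-sym x y
  edge-sym′ (inj₁ x) (inj₂ b) = refl
  edge-sym′ (inj₂ b) (inj₁ x) = refl
  edge-sym′ (inj₂ b) (inj₂ c) = xor-comm b c

  terminal′ : Terminal → V′
  terminal′ (side b) = inj₂ b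
  terminal′ tip      = inj₁ (terminal tip)

  vs′ : List V′
  vs′ = inj₂ true ∷ inj₂ false ∷ map inj₁ vs

  rung~ : ∀ b → (inj₂ b) ~′ (inj₂ (not b))
  rung~ true  = tt
  rung~ false = tt

  side~ : ∀ b → inj₁ (terminal (side b)) ~′ inj₂ b
  side~ b with terminal (side b) ≟ⱽ terminal (side b)
  ... | yes _ = tt
  ... | no ¬p = ⊥-elim (¬p refl)

  ~side : ∀ b → inj₂ b ~′ inj₁ (terminal (side b))
  ~side = side~

  old : ∀ {x y L} → HP _~_ L x y → HP _~′_ (map inj₁ L) (inj₁ x) (inj₁ y)
  old = mapHP inj₁ (λ r → r)

  old₂ : ∀ {x y z w L} → HP₂ _~_ L x y z w → HP₂ _~′_ (map inj₁ L) (inj₁ x) (inj₁ y) (inj₁ z) (inj₁ w)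
  old₂ = mapHP₂ inj₁ (λ r → r)

  rungs : ∀ b → inj₂ b ∷ inj₂ (not b) ∷ map inj₁ vs ↭ vs′
  rungs true  = ↭-refl
  rungs false = ↭-swap _ _ ↭-refl

  module _ (b : Bool) where
    private
      r s : List V′
      r = [ inj₂ b ]
      s = [ inj₂ (not b) ]
      M₀ : List V′
      M₀ = map inj₁ vs

    last-rung : M₀ ++ r ++ s ↭ vs′
    last-rung = ↭-trans (solve 3 (λ M r s → M ⊕ (r ⊕ s) ⊜ r ⊕ (s ⊕ M)) ↭-refl M₀ r s) (rungs b)

    around-rungs : r ++ M₀ ++ s ↭ vs′
    around-rungs = ↭-trans (solve 3 (λ M r s → r ⊕ (M ⊕ s) ⊜ r ⊕ (s ⊕ M)) ↭-refl M₀ r s) (rungs b)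

    middle-rung : ∀ L M → L ++ M ↭ M₀ → L ++ r ++ s ++ M ↭ vs′
    middle-rung L M p = ↭-trans
      (solve 4 (λ L M r s → L ⊕ (r ⊕ (s ⊕ M)) ⊜ r ⊕ (s ⊕ (L ⊕ M))) ↭-refl L M r s)
      (↭-trans (↭-prep _ (↭-prep _ p)) (rungs b))

    split-rung : ∀ L M → L ++ M ↭ M₀ → (L ++ r) ++ (s ++ M) ↭ vs′
    split-rung L M p = ↭-trans (↭-reflexive (++-assoc L r (s ++ M))) (middle-rung L M p)

    split-sides : ∀ L M → L ++ M ↭ M₀ → (L ++ r) ++ (M ++ s) ↭ vs′
    split-sides L M p = ↭-trans
      (solve 4 (λ L M r s → (L ⊕ r) ⊕ (M ⊕ s) ⊜ L ⊕ (r ⊕ (s ⊕ M))) ↭-refl L M r s) (middle-rung L M p)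

    left-rung : ∀ L M → L ++ M ↭ M₀ → (L ++ r ++ s) ++ M ↭ vs′
    left-rung L M p = ↭-trans
      (solve 4 (λ L M r s → (L ⊕ (r ⊕ s)) ⊕ M ⊜ L ⊕ (r ⊕ (s ⊕ M))) ↭-refl L M r s) (middle-rung L M p)

  across′ : ∀ b → HP _~′_ vs′ (inj₂ b) (inj₂ (not b))
  across′ b = reorder (around-rungs b)
    (single (inj₂ b) ⟨ ~side b ⟩ old (across b) ⟨ side~ (not b) ⟩ single (inj₂ (not b)))

  to-tip′ : ∀ b → HP _~′_ vs′ (inj₂ b) (terminal′ tip)
  to-tip′ b = reorder (rungs b)
    (single (inj₂ b) ⟨ rung~ b ⟩ single (inj₂ (not b)) ⟨ ~side (not b) ⟩ old (to-tip (not b)))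

  leave : ∀ {u} b → HP _~_ vs u (terminal (side b)) → HP _~′_ vs′ (inj₁ u) (inj₂ (not b))
  leave b h = reorder (last-rung b) (old h ⟨ side~ b ⟩ single (inj₂ b) ⟨ rung~ b ⟩ single (inj₂ (not b)))

  -- The rung bridges the old split at its two sides, which gives the path to the tip; leaving out
  -- the edge of the rung gives the new split.
  exit′ : ∀ u → Exit _~′_ vs′ terminal′ u
  exit′ (inj₁ u) with exit u
  ... | both f = both λ where
          true  → leave false (f false)
          false → leave true (f true)
  ... | turn b h k c s with old₂ s
  ...   | hp₂ {L} {M} p q perm = turn (not b) (leave b h)
          (reorder (middle-rung c L M perm) (p ⟨ side~ c ⟩ single (inj₂ c) ⟨ rung~ c ⟩ single (inj₂ (not c)) ⟨ ~side (not c) ⟩ q))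
          c (hp₂ (p ⟨ side~ c ⟩ single (inj₂ c)) (single (inj₂ (not c)) ⟨ ~side (not c) ⟩ q) (split-rung c L M perm))
  exit′ (inj₂ b) = turn (not b) (across′ b) (to-tip′ b) b
    (hp₂ (single (inj₂ b)) (single (inj₂ (not b)) ⟨ ~side (not b) ⟩ old (to-tip (not b))) (rungs b))

  -- With `both`, v can leave by the side opposite to b, and the new vertex b leaves alone. With
  -- `turn`, v leaves by the tip and the other path takes the whole rung.
  exits-rung : ∀ b v → Exits _~′_ vs′ terminal′ (inj₂ b) (inj₁ v)
  exits-rung b v with exit v
  ... | both f = sides b (hp₂ (single (inj₂ b)) (old (f (not b)) ⟨ side~ (not b) ⟩ single (inj₂ (not b)))
                         (around-rungs b))
  ... | turn _ _ k _ _ = tipʳ (not b) (hp₂ (single (inj₂ b) ⟨ rung~ b ⟩ single (inj₂ (not b))) (old k) (rungs b))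

  exits-rungs : ∀ b → Exits _~′_ vs′ terminal′ (inj₂ b) (inj₂ (not b))
  exits-rungs b = tipˡ (not b) (hp₂ (single (inj₂ b) ⟨ ~side b ⟩ old (to-tip b)) (single (inj₂ (not b)))
                     (around-rungs b))

  -- Two old paths that leave by the sides get one new vertex each. If one leaves by the tip, the
  -- other takes both new vertices and comes out at the opposite side.
  exits′ : ∀ {u v} → u ≢ v → Exits _~′_ vs′ terminal′ u v
  exits′ {inj₁ u} {inj₁ v} u≢v with exits (u≢v ∘ cong inj₁)
  ... | sides b h with old₂ h
  ...   | hp₂ {L} {M} p q perm = sides b (hp₂ (p ⟨ side~ b ⟩ single (inj₂ b))
                           (q ⟨ side~ (not b) ⟩ single (inj₂ (not b))) (split-sides b L M perm))
  exits′ {inj₁ u} {inj₁ v} u≢v | tipʳ b h with old₂ h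
  ...   | hp₂ {L} {M} p q perm = tipʳ (not b)
            (hp₂ (p ⟨ side~ b ⟩ single (inj₂ b) ⟨ rung~ b ⟩ single (inj₂ (not b))) q (left-rung b L M perm))
  exits′ {inj₁ u} {inj₁ v} u≢v | tipˡ b h with old₂ (swapHP₂ h)
  ...   | hp₂ {L} {M} p q perm = tipˡ (not b) (swapHP₂
            (hp₂ (p ⟨ side~ b ⟩ single (inj₂ b) ⟨ rung~ b ⟩ single (inj₂ (not b))) q (left-rung b L M perm)))
  exits′ {inj₂ b} {inj₁ v} _ = exits-rung b v
  exits′ {inj₁ u} {inj₂ c} _ = swapExits (exits-rung c u)
  exits′ {inj₂ true}  {inj₂ true}  u≢v = ⊥-elim (u≢v refl)
  exits′ {inj₂ true}  {inj₂ false} _   = exits-rungs true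
  exits′ {inj₂ false} {inj₂ true}  _   = exits-rungs false
  exits′ {inj₂ false} {inj₂ false} u≢v = ⊥-elim (u≢v refl)

  attach : V ⊎ Terminal → V′ ⊎ Terminal
  attach (inj₁ x)        = inj₁ (inj₁ x)
  attach (inj₂ (side b)) = inj₁ (inj₂ b)
  attach (inj₂ tip)      = inj₂ tip

  nb′ : V′ → List (V′ ⊎ Terminal)
  nb′ (inj₁ x) = map attach (nb x)
  nb′ (inj₂ b) = inj₁ (inj₂ (not b)) ∷ inj₁ (inj₁ (terminal (side b))) ∷ inj₂ (side b) ∷ []

  nb-edge′ : ∀ {x y} → x ~′ y → inj₁ y ∈ nb′ x
  nb-edge′ {inj₁ x} {inj₁ y} r = ∈-map⁺ attach (nb-edge r)
  nb-edge′ {inj₁ x} {inj₂ b} r with x ≟ⱽ terminal (side b)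
  ... | yes refl = ∈-map⁺ attach (nb-terminal (side b))
  nb-edge′ {inj₂ b} {inj₁ x} r with x ≟ⱽ terminal (side b)
  ... | yes refl = there (here refl)
  nb-edge′ {inj₂ true}  {inj₂ false} r = here refl
  nb-edge′ {inj₂ false} {inj₂ true}  r = here refl

  nb-terminal′ : ∀ i → inj₂ i ∈ nb′ (terminal′ i)
  nb-terminal′ (side b) = there (there (here refl))
  nb-terminal′ tip      = ∈-map⁺ attach (nb-terminal tip)

  length-nb′ : ∀ x {k} → length (nb x) ≤ k → length (nb′ (inj₁ x)) ≤ k
  length-nb′ x = subst (_≤ _) (≡-sym (length-map attach (nb x)))

  cubic-edge′ : ∀ x y → x ~′ y → length (nb′ x) ≤ 3 ⊎ length (nb′ y) ≤ 3
  cubic-edge′ (inj₁ x) (inj₁ y) r = Sum.map (length-nb′ x) (length-nb′ y) (cubic-edge r)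
  cubic-edge′ (inj₁ x) (inj₂ b) r = inj₂ ℕₚ.≤-refl
  cubic-edge′ (inj₂ b) y        r = inj₁ ℕₚ.≤-refl

  gadget : Gadget
  gadget = record
    { _≟ⱽ_ = Sumₚ.≡-dec _≟ⱽ_ Boolₚ._≟_
    ; vs = vs′
    ; vs! = ((λ ()) ∷ ¬Any⇒All¬ _ new) ∷ ¬Any⇒All¬ _ new ∷ Unique-map⁺ Sumₚ.inj₁-injective vs!
    ; vs-full = λ where
        (inj₁ x)     → there (there (∈-map⁺ inj₁ (vs-full x)))
        (inj₂ true)  → here refl
        (inj₂ false) → there (here refl)
    ; edge = edge′ ; edge-sym = edge-sym′
    ; edge-irr = λ { (inj₁ x) → edge-irr x ; (inj₂ b) → xor-same b }
    ; terminal = terminal′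
    ; across = across′ ; to-tip = to-tip′ ; exit = exit′ ; exits = exits′
    ; nb = nb′ ; nb-edge = λ {x} {y} → nb-edge′ {x} {y} ; nb-terminal = nb-terminal′
    ; cubic-edge = λ {x} {y} → cubic-edge′ x y
    ; cubic-tip = length-nb′ (terminal tip) cubic-tip
    ; excess = excess
    ; nb≤ = λ { (inj₁ x) → length-nb′ x (nb≤ x) ; (inj₂ b) → s≤s (s≤s (s≤s z≤n)) } }
    where
    new : ∀ {b} {xs : List V} → ¬ (inj₂ b ∈ map inj₁ xs)
    new p = case ∈-map⁻ inj₁ p of λ ()

  length-vs : length vs′ ≡ 2 + length vs
  length-vs = cong (2 +_) (length-map inj₁ vs)

-- Graphs on the positions of an enumeration

-- In `H` the vertex c keeps at most two neighbours, fewer than hamiltonian-connectedness allows.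
critical : ∀ {n} (G H : Graph n) → 4 ≤ n → ∀ {c d} l → (∀ {w} → Adj G c w → w ∈ l) → length l ≤ 3 →
           Adj G c d → (∀ {w} → Adj H c w → Adj G c w × w ≢ d) → ¬ HamConnected H
critical G H 4≤n {c} {d} l sub ≤3 c~d H⊆ hc with ∈-∃++ (sub c~d)
... | as , bs , refl = ℕₚ.1+n≰n (ℕₚ.≤-trans (subst (_≤ 3) len ≤3) (three-neighbours H 4≤n hc (as ++ bs) sub′))
  where
  len : length (as ++ d ∷ bs) ≡ suc (length (as ++ bs))
  len = ↭-length (shift d as bs)
  sub′ : ∀ {w} → Adj H c w → w ∈ as ++ bs
  sub′ r with H⊆ r
  ... | r′ , w≢d with ∈-++⁻ as (sub r′)
  ...   | inj₁ p          = ∈-++⁺ˡ p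
  ...   | inj₂ (here e)   = ⊥-elim (w≢d e)
  ...   | inj₂ (there p)  = ∈-++⁺ʳ as p

-- Vertices of an arbitrary type are replaced by their positions in the enumeration `ws`. The lists
-- `nb` cover the neighbours, which gives the upper bounds on degrees that minimality rests on.
module Realise {W : Set} (ws : List W) (ws! : Unique ws) (ws-full : ∀ w → w ∈ ws)
  (edge : W → W → Bool) (edge-sym : ∀ x y → edge x y ≡ edge y x) (edge-irr : ∀ x → edge x x ≡ false)
  (ham : ∀ {x y} → x ≢ y → HP (λ x y → T (edge x y)) ws x y)
  (nb : W → List W) (nb-edge : ∀ x y → T (edge x y) → y ∈ nb x)
  (cubic-edge : ∀ x y → T (edge x y) → length (nb x) ≤ 3 ⊎ length (nb y) ≤ 3)
  (4≤n : 4 ≤ length ws) where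

  n = length ws

  at : Fin n → W
  at = lookup ws

  position : W → Fin n
  position w = index (ws-full w)

  at-position : ∀ w → at (position w) ≡ w
  at-position w = ≡-sym (lookup-index (ws-full w))

  at-injective : ∀ {i j} → at i ≡ at j → i ≡ j
  at-injective = injective ws ws!
    where
    ∈-lookup : ∀ (l : List W) i → lookup l i ∈ l
    ∈-lookup (x ∷ l) zero    = here refl
    ∈-lookup (x ∷ l) (suc i) = there (∈-lookup l i)
    injective : ∀ l → Unique l → ∀ {i j} → lookup l i ≡ lookup l j → i ≡ j
    injective (x ∷ l) u       {zero}  {zero}  e = refl
    injective (x ∷ l) (p ∷ u) {zero}  {suc j} e = ⊥-elim (All¬⇒¬Any p (subst (_∈ l) (≡-sym e) (∈-lookup l j)))
    injective (x ∷ l) (p ∷ u) {suc i} {zero}  e = ⊥-elim (All¬⇒¬Any p (subst (_∈ l) e (∈-lookup l i)))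
    injective (x ∷ l) (p ∷ u) {suc i} {suc j} e = cong suc (injective l u e)

  position-at : ∀ i → position (at i) ≡ i
  position-at i = at-injective (at-position (at i))

  graph : Graph n
  graph = record
    { adj = λ i j → edge (at i) (at j)
    ; sym = λ i j → edge-sym (at i) (at j)
    ; irref = λ i → edge-irr (at i) }

  hamConnected : HamConnected graph
  hamConnected i j i≢j with ham (i≢j ∘ at-injective)
  ... | hp {xs} w p = toHamPath graph i≢j
          ( map position xs
          , subst₂ (λ i j → Walk (Adj graph) i (map position xs) j) (position-at i) (position-at j)
              (mapWalk position (λ {x} {y} → subst₂ (λ x y → T (edge x y)) (≡-sym (at-position x)) (≡-sym (at-position y))) w)
          , Unique-map⁺ (λ {x} {y} e → ≡-trans (≡-sym (at-position x)) (≡-trans (cong at e) (at-position y)))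
              (Unique-resp-↭ (↭-sym p) ws!)
          , λ k → subst (_∈ map position xs) (position-at k) (∈-map⁺ position (∈-resp-↭ (↭-sym p) (ws-full (at k)))))

  neighbour-positions : ∀ {i j} → Adj graph i j → j ∈ map position (nb (at i))
  neighbour-positions {i} {j} r = subst (_∈ _) (position-at j) (∈-map⁺ position (nb-edge (at i) (at j) r))

  length-positions : ∀ (l : List W) {k} → length l ≤ k → length (map position l) ≤ k
  length-positions l = subst (_≤ _) (≡-sym (length-map position l))

  minimal : MinHamConnected graph
  minimal = hamConnected , λ i j i~j → case cubic-edge (at i) (at j) i~j of λ where
    (inj₁ ≤3) → critical graph (removeEdge graph i j) 4≤n {i} {j} (map position (nb (at i))) neighbour-positions
      (length-positions (nb (at i)) ≤3) i~j (λ r → let r′ , h = removeEdge⁻ graph r in r′ , λ e → h (refl , e))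
    (inj₂ ≤3) → critical graph (removeEdge graph i j) 4≤n {j} {i} (map position (nb (at j))) neighbour-positions
      (length-positions (nb (at j)) ≤3) (Adj-sym graph {i} {j} i~j) (λ {w} r →
        let r′ , h = removeEdge⁻ graph (Adj-sym (removeEdge graph i j) {j} {w} r)
        in Adj-sym graph {w} {j} r′ , λ e → h (e , refl))

  -- The covering lists bound every degree from above; at x, where the list is exact, the bound is
  -- attained.
  maxDegree : ∀ Δ → (∀ x → length (nb x) ≤ Δ) → ∀ x → Unique (nb x) → (∀ {y} → y ∈ nb x → T (edge x y)) →
              length (nb x) ≡ Δ → MaxDegree graph Δ
  maxDegree Δ nb≤ x nb! sound len =
    bound , position x , ℕₚ.≤-antisym (bound (position x))
      (subst (_≤ _) (≡-trans (length-map position (nb x)) len)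
        (degree-≥ graph (Unique-map⁺ (λ {x} {y} e → ≡-trans (≡-sym (at-position x)) (≡-trans (cong at e) (at-position y))) nb!)
          λ p → case ∈-map⁻ position p of λ { (y , y∈ , refl) →
            subst₂ (λ x y → T (edge x y)) (≡-sym (at-position x)) (≡-sym (at-position y)) (sound y∈) }))
    where
    bound : ∀ i → degree graph i ≤ Δ
    bound i = ℕₚ.≤-trans (degree-≤ graph {i} neighbour-positions) (length-positions (nb (at i)) (nb≤ (at i)))

-- A gadget joined to a fan

-- This cuts after x, whereas `cut∈` cuts before it.
fromWalk : Walk R a L b → x ∈ L → ∃ λ xs → Walk R a xs x ×
           ((x ≡ b × L ≡ xs) ⊎ (∃₂ λ y ys → R x y × Walk R y ys b × L ≡ xs ++ ys))
fromWalk (stop a)          (here refl) = _ , stop a , inj₁ (refl , refl)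
fromWalk (_∷_ {a = a} r w) (here refl) = _ , stop a , inj₂ (_ , _ , r , w , refl)
fromWalk (_∷_ {a = a} r w) (there x∈) with fromWalk w x∈
... | xs , v , inj₁ (e , refl)              = _ , r ∷ v , inj₁ (e , refl)
... | xs , v , inj₂ (y , ys , s , u , refl) = _ , r ∷ v , inj₂ (y , ys , s , u , refl)

next : ∀ {m} → Fin m → Fin m → Bool
next zero    (suc zero) = true
next (suc i) (suc j)    = next i j
next _       _          = false

next-irr : ∀ {m} (i : Fin m) → next i i ≡ false
next-irr zero    = refl
next-irr (suc i) = next-irr i

next⇒ : ∀ {m} {i j : Fin (suc m)} → T (next i j) → ∃ λ k → i ≡ inject₁ k × j ≡ suc k
next⇒ {suc m} {zero}  {suc zero} _ = zero , refl , refl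
next⇒ {suc m} {suc i} {suc j} r with next⇒ {m} {i} {j} r
... | k , refl , refl = suc k , refl , refl

module Fan (X : Gadget) (r : ℕ) where

  open Gadget X

  -- With Δ = r + 3 the rim has Δ - 1 vertices, and the tip is the last neighbour of the hub. The
  -- rim has at least two vertices, so its ends differ.
  Rim = Fin (suc (suc r))

  data W : Set where
    hub   : W
    rim   : Rim → W
    inner : V → W

  end : Bool → Rim
  end true  = zero
  end false = fromℕ (suc r)

  link : V → Rim → Bool → Bool
  link x i b = does (x ≟ⱽ terminal (side b)) ∧ does (i ≟ end b)

  edgeᵂ : W → W → Bool
  edgeᵂ hub       hub       = false
  edgeᵂ hub       (rim _)   = true
  edgeᵂ (rim _)   hub       = true
  edgeᵂ hub       (inner x) = does (x ≟ⱽ terminal tip)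
  edgeᵂ (inner x) hub       = does (x ≟ⱽ terminal tip)
  edgeᵂ (rim i)   (rim j)   = next i j ∨ next j i
  edgeᵂ (rim i)   (inner x) = link x i true ∨ link x i false
  edgeᵂ (inner x) (rim i)   = link x i true ∨ link x i false
  edgeᵂ (inner x) (inner y) = edge x y

  _≈_ : W → W → Set
  x ≈ y = T (edgeᵂ x y)

  edgeᵂ-sym : ∀ x y → edgeᵂ x y ≡ edgeᵂ y x
  edgeᵂ-sym hub       hub       = refl
  edgeᵂ-sym hub       (rim _)   = refl
  edgeᵂ-sym (rim _)   hub       = refl
  edgeᵂ-sym hub       (inner x) = refl
  edgeᵂ-sym (inner x) hub       = refl
  edgeᵂ-sym (rim i)   (rim j)   = Boolₚ.∨-comm (next i j) (next j i)
  edgeᵂ-sym (rim i)   (inner x) = refl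
  edgeᵂ-sym (inner x) (rim i)   = refl
  edgeᵂ-sym (inner x) (inner y) = edge-sym x y

  ≈-sym : ∀ {x y} → x ≈ y → y ≈ x
  ≈-sym {x} {y} = subst T (edgeᵂ-sym x y)

  edgeᵂ-irr : ∀ x → edgeᵂ x x ≡ false
  edgeᵂ-irr hub       = refl
  edgeᵂ-irr (rim i)   = cong₂ _∨_ (next-irr i) (next-irr i)
  edgeᵂ-irr (inner x) = edge-irr x

  rims : List W
  rims = map rim (allFin _)

  inners : List W
  inners = map inner vs

  ws : List W
  ws = hub ∷ rims ++ inners

  ws! : Unique ws
  ws! = ¬Any⇒All¬ _ hub∉ ∷ ++⁺ (Unique-map⁺ (λ { refl → refl }) (allFin⁺ _)) (Unique-map⁺ (λ { refl → refl }) vs!)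
                               (λ (p , q) → disjoint p q)
    where
    hub∉ : hub ∉ rims ++ inners
    hub∉ p with ∈-++⁻ rims p
    ... | inj₁ q = case ∈-map⁻ rim q of λ ()
    ... | inj₂ q = case ∈-map⁻ inner q of λ ()
    disjoint : ∀ {x} → x ∈ rims → x ∈ inners → ⊥
    disjoint p q with ∈-map⁻ rim p | ∈-map⁻ inner q
    ... | _ , _ , refl | _ , _ , ()

  ws-full : ∀ x → x ∈ ws
  ws-full hub       = here refl
  ws-full (rim i)   = there (∈-++⁺ˡ (∈-map⁺ rim (∈-allFin i)))
  ws-full (inner x) = there (∈-++⁺ʳ rims (∈-map⁺ inner (vs-full x)))

  private
    refl-does : ∀ x → does (x ≟ⱽ x) ≡ true
    refl-does x with x ≟ⱽ x
    ... | yes _ = refl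
    ... | no ¬p = ⊥-elim (¬p refl)
    refl-doesᶠ : ∀ {m} (i : Fin m) → does (i ≟ i) ≡ true
    refl-doesᶠ i with i ≟ i
    ... | yes _ = refl
    ... | no ¬p = ⊥-elim (¬p refl)

  tip≈hub : inner (terminal tip) ≈ hub
  tip≈hub rewrite refl-does (terminal tip) = tt

  side≈rim : ∀ b → inner (terminal (side b)) ≈ rim (end b)
  side≈rim true rewrite refl-does (terminal (side true)) = tt
  side≈rim false rewrite refl-does (terminal (side false)) | refl-doesᶠ (end false) =
    subst T (≡-sym (Boolₚ.∨-zeroʳ _)) tt

  rim≈side : ∀ b → rim (end b) ≈ inner (terminal (side b))
  rim≈side b = ≈-sym {inner (terminal (side b))} {rim (end b)} (side≈rim b)

  inHP : ∀ {u v L} → HP _~_ L u v → HP _≈_ (map inner L) (inner u) (inner v)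
  inHP = mapHP inner (λ r → r)

  rim-walk : Walk (λ i j → rim i ≈ rim j) zero (allFin _) (end false)
  rim-walk = steps (suc r)
    where
    Step : ∀ {m} → Fin m → Fin m → Set
    Step i j = T (next i j ∨ next j i)
    steps : ∀ m → Walk Step zero (allFin (suc m)) (fromℕ m)
    steps zero    = stop zero
    steps (suc m) = tt ∷ subst (λ l → Walk Step (suc zero) l (suc (fromℕ m))) (map-tabulate (λ i → i) suc)
                           (mapWalk suc (λ r → r) (steps m))

  oriented : ∀ b → ∃ λ l → Walk (λ i j → rim i ≈ rim j) (end b) l (end (not b)) × l ↭ allFin _
  oriented true  = _ , rim-walk , ↭-refl
  oriented false = _ , reverseWalk (λ {i} {j} → ≈-sym {rim i} {rim j}) rim-walk , ↭-reverse _

  on-rim : ∀ {i l j} → Walk (λ i j → rim i ≈ rim j) i l j → HP _≈_ (map rim l) (rim i) (rim j)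
  on-rim w = mapHP rim (λ r → r) (whole w)

  rev : ∀ {L x y} → HP _≈_ L x y → HP _≈_ L y x
  rev = reverseHP λ {x} {y} → ≈-sym {x} {y}

  whole-rim : ∀ b → HP _≈_ rims (rim (end b)) (rim (end (not b)))
  whole-rim b with oriented b
  ... | l , w , p = reorder (↭-map⁺ rim p) (on-rim w)

  ends≢ : ∀ b → end b ≢ end (not b)
  ends≢ true ()
  ends≢ false ()

  data Cut (b : Bool) (i : Rim) : Set where
    at-end : i ≡ end b → Cut b i
    cut-at : ∀ {j L M} → HP _≈_ L (rim (end b)) (rim j) → HP _≈_ M (rim i) (rim (end (not b))) →
             L ++ M ↭ rims → Cut b i

  cut-rim : ∀ b i → Cut b i
  cut-rim b i with oriented b
  ... | l , w , p with cut∈ w (∈-resp-↭ (↭-sym p) (∈-allFin i))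
  ...   | inj₁ e = at-end e
  ...   | inj₂ (j , xs , ys , w₁ , w₂ , refl , _) =
          cut-at (on-rim w₁) (on-rim w₂) (↭-trans (↭-reflexive (≡-sym (map-++ rim xs ys))) (↭-map⁺ rim p))

  -- The rim is cut before its last vertex and the hub, adjacent to all of the rim, is put into the
  -- gap.
  hub-inserted : ∀ b → HP _≈_ (hub ∷ rims) (rim (end b)) (rim (end (not b)))
  hub-inserted b with cut-rim b (end (not b))
  ... | at-end e = ⊥-elim (ends≢ b (≡-sym e))
  ... | cut-at {j} {L} {M} p q perm = reorder (↭-trans (shift hub L M) (↭-prep hub perm)) (p ⟨ tt ⟩ single hub ⟨ tt ⟩ q)

  inner-tip-inner : ∀ b {u v} → HP₂ _~_ vs u (terminal (side b)) v (terminal tip) → HP _≈_ ws (inner u) (inner v)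
  inner-tip-inner b h with mapHP₂ {S = _≈_} inner (λ r → r) h
  ... | hp₂ {L} {M} p q perm = reorder arranged
          (p ⟨ side≈rim b ⟩ whole-rim b ⟨ tt ⟩ single hub ⟨ tip≈hub ⟩ rev q)
    where
    arranged : L ++ rims ++ hub ∷ M ↭ ws
    arranged = ↭-trans (solve 4 (λ L R h M → L ⊕ (R ⊕ (h ⊕ M)) ⊜ h ⊕ (R ⊕ (L ⊕ M))) ↭-refl L rims [ hub ] M)
                       (↭-prep hub (↭-++⁺ ↭-refl perm))

  -- Between two sides, the outside is traversed along the rim with the hub inserted; between a side
  -- and the tip, along the whole rim and then the hub.
  inner-inner : ∀ {u v} → Exits _~_ vs terminal u v → HP _≈_ ws (inner u) (inner v)
  inner-inner (sides b h) with mapHP₂ {S = _≈_} inner (λ r → r) h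
  ... | hp₂ {L} {M} p q perm = reorder arranged
          (p ⟨ side≈rim b ⟩ hub-inserted b ⟨ rim≈side (not b) ⟩ rev q)
    where
    arranged : L ++ hub ∷ rims ++ M ↭ ws
    arranged = ↭-trans (solve 3 (λ L R M → L ⊕ (R ⊕ M) ⊜ R ⊕ (L ⊕ M)) ↭-refl L (hub ∷ rims) M)
                       (↭-++⁺ (↭-refl {x = hub ∷ rims}) perm)
  inner-inner (tipʳ b h) = inner-tip-inner b h
  inner-inner (tipˡ b h) = rev (inner-tip-inner b (swapHP₂ h))

  inner-hub : ∀ {u} → Exit _~_ vs terminal u → HP _≈_ ws (inner u) hub
  inner-hub e with leave e
    where
    leave : ∀ {u} → Exit _~_ vs terminal u → ∃ λ b → HP _~_ vs u (terminal (side b))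
    leave (both f)         = true , f true
    leave (turn b h _ _ _) = b , h
  ... | b , h = reorder (solve 3 (λ M R h → M ⊕ (R ⊕ h) ⊜ h ⊕ (R ⊕ M)) ↭-refl inners rims [ hub ])
                  (inHP h ⟨ side≈rim b ⟩ whole-rim b ⟨ tt ⟩ single hub)

  -- From `end b` the path goes up to the vertex before i, jumps over the hub to the other end and
  -- comes back to i.
  rim-turn : ∀ b {i} → i ≢ end b → HP _≈_ (hub ∷ rims) (rim (end b)) (rim i)
  rim-turn b {i} i≢ with cut-rim b i
  ... | at-end e = ⊥-elim (i≢ e)
  ... | cut-at {j} {L} {M} p q perm =
          reorder (↭-trans (shift hub L M) (↭-prep hub perm)) (p ⟨ tt ⟩ single hub ⟨ tt ⟩ rev q)

  -- `rim-turn` works unless the rim is entered at i itself. In that case `both` offers the other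
  -- side, and `turn` offers the tip, from which the hub and then the rim from its far end lead to
  -- i.
  inner-rim : ∀ {u} i → Exit _~_ vs terminal u → HP _≈_ ws (inner u) (rim i)
  inner-rim {u} i e = reorder (++-comm inners (hub ∷ rims)) (path e)
    where
    path : Exit _~_ vs terminal u → HP _≈_ (inners ++ hub ∷ rims) (inner u) (rim i)
    path (both f) with i ≟ zero
    ... | no i≢    = inHP (f true) ⟨ side≈rim true ⟩ rim-turn true i≢
    ... | yes refl = inHP (f false) ⟨ side≈rim false ⟩ rim-turn false (ends≢ true)
    path (turn b h k _ _) with i ≟ end b
    ... | no i≢    = inHP h ⟨ side≈rim b ⟩ rim-turn b i≢
    ... | yes refl = inHP k ⟨ tip≈hub ⟩ single hub ⟨ tt ⟩ rev (whole-rim b)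

  -- If i is the first rim vertex, the path takes the gadget from the tip and then the rim
  -- backwards. Otherwise it goes from the hub to the vertex before i, back to the start of the rim,
  -- across the gadget, and from the far end back to i.
  hub-rim : ∀ i → HP _≈_ ws hub (rim i)
  hub-rim i with cut-rim true i
  ... | at-end refl = reorder (↭-prep hub (++-comm inners rims))
          (single hub ⟨ tip≈hub ⟩ rev (inHP (to-tip false)) ⟨ side≈rim false ⟩ whole-rim false)
  ... | cut-at {j} {L} {M} p q perm = reorder arranged
          (single hub ⟨ tt ⟩ rev p ⟨ rim≈side true ⟩ inHP (across true) ⟨ side≈rim false ⟩ rev q)
    where
    arranged : hub ∷ L ++ inners ++ M ↭ ws
    arranged = ↭-prep hub (↭-trans (solve 3 (λ L I M → L ⊕ (I ⊕ M) ⊜ (L ⊕ M) ⊕ I) ↭-refl L inners M)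
                                   (↭-++⁺ perm ↭-refl))

  -- Here i precedes j. The path goes from i back to the start of the rim and through the gadget. If
  -- j is the last rim vertex, it continues by the tip, the hub and i⁺ ... j; otherwise it comes
  -- back along the rim to the successor of j and then takes the hub and i⁺ ... j.
  rim-rim-ordered : ∀ {F T i i⁺ j} → Walk (λ i j → rim i ≈ rim j) zero F i →
    Walk (λ i j → rim i ≈ rim j) i⁺ T (end false) → allFin _ ≡ F ++ T → j ∈ T → HP _≈_ ws (rim i) (rim j)
  rim-rim-ordered {F} w₁ w₂ eq j∈ with fromWalk w₂ j∈
  ... | K , w , inj₁ (refl , refl) = reorder arranged
          (rev (on-rim w₁) ⟨ rim≈side true ⟩ inHP (to-tip true) ⟨ tip≈hub ⟩ single hub ⟨ tt ⟩ on-rim w)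
    where
    arranged : map rim F ++ inners ++ hub ∷ map rim K ↭ ws
    arranged = ↭-trans
      (solve 4 (λ F I h K → F ⊕ (I ⊕ (h ⊕ K)) ⊜ h ⊕ ((F ⊕ K) ⊕ I)) ↭-refl (map rim F) inners [ hub ] (map rim K))
      (↭-reflexive (cong (λ l → hub ∷ l ++ inners) (≡-sym (≡-trans (cong (map rim) eq) (map-++ rim F K)))))
  ... | K , w , inj₂ (_ , L , _ , w₃ , refl) = reorder arranged
          (rev (on-rim w₁) ⟨ rim≈side true ⟩ inHP (across true) ⟨ side≈rim false ⟩ rev (on-rim w₃)
            ⟨ tt ⟩ single hub ⟨ tt ⟩ on-rim w)
    where
    arranged : map rim F ++ inners ++ map rim L ++ hub ∷ map rim K ↭ ws
    arranged = ↭-trans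
      (solve 5 (λ F I L h K → F ⊕ (I ⊕ (L ⊕ (h ⊕ K))) ⊜ h ⊕ ((F ⊕ (K ⊕ L)) ⊕ I)) ↭-refl
         (map rim F) inners (map rim L) [ hub ] (map rim K))
      (↭-reflexive (cong (λ l → hub ∷ l ++ inners) (≡-sym (≡-trans (cong (map rim) eq)
        (≡-trans (map-++ rim F (K ++ L)) (cong (map rim F ++_) (map-++ rim K L)))))))

  rim-rim : ∀ {i j} → i ≢ j → HP _≈_ ws (rim i) (rim j)
  rim-rim {i} {j} i≢j with fromWalk rim-walk (∈-allFin i)
  ... | F , w₁ , inj₁ (refl , eq) with fromWalk w₁ (subst (j ∈_) eq (∈-allFin j))
  ...   | _ , _ , inj₁ (e , _) = ⊥-elim (i≢j (≡-sym e))
  ...   | F′ , w , inj₂ (_ , K , _ , w₃ , eq′) = rev (rim-rim-ordered w w₃ (≡-trans eq eq′) (last∈ w₃))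
  rim-rim {i} {j} i≢j | F , w₁ , inj₂ (_ , M , r , w₂ , eq) with ∈-++⁻ F (subst (j ∈_) eq (∈-allFin j))
  ... | inj₂ j∈ = rim-rim-ordered w₁ w₂ eq j∈
  ... | inj₁ j∈ with fromWalk w₁ j∈
  ...   | _ , _ , inj₁ (e , _) = ⊥-elim (i≢j (≡-sym e))
  ...   | F′ , w , inj₂ (_ , K , _ , w₃ , refl) =
          rev (rim-rim-ordered w (join w₃ r w₂) (≡-trans eq (++-assoc F′ K M)) (∈-++⁺ˡ (last∈ w₃)))

  ham : ∀ {x y} → x ≢ y → HP _≈_ ws x y
  ham {hub}     {hub}     x≢y = ⊥-elim (x≢y refl)
  ham {hub}     {rim i}   _   = hub-rim i
  ham {hub}     {inner v} _   = rev (inner-hub (exit v))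
  ham {rim i}   {hub}     _   = rev (hub-rim i)
  ham {rim i}   {rim j}   x≢y = rim-rim (x≢y ∘ cong rim)
  ham {rim i}   {inner v} _   = rev (inner-rim i (exit v))
  ham {inner u} {hub}     _   = inner-hub (exit u)
  ham {inner u} {rim i}   _   = inner-rim i (exit u)
  ham {inner u} {inner v} x≢y = inner-inner (exits (x≢y ∘ cong inner))

  place : V ⊎ Terminal → W
  place (inj₁ x)        = inner x
  place (inj₂ (side b)) = rim (end b)
  place (inj₂ tip)      = hub

  before : Rim → W
  before zero    = inner (terminal (side true))
  before (suc i) = rim (inject₁ i)

  after : Rim → W
  after i with view i
  ... | ‵fromℕ     = inner (terminal (side false))
  ... | ‵inject₁ j = rim (suc j)

  nbᵂ : W → List W
  nbᵂ hub       = inner (terminal tip) ∷ rims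
  nbᵂ (rim i)   = hub ∷ before i ∷ after i ∷ []
  nbᵂ (inner x) = map place (nb x)

  after-end : after (end false) ≡ inner (terminal (side false))
  after-end rewrite view-fromℕ (suc r) = refl

  after-inject₁ : ∀ k → after (inject₁ k) ≡ rim (suc k)
  after-inject₁ k rewrite view-inject₁ k = refl

  link⇒ : ∀ x i b → T (link x i b) → x ≡ terminal (side b) × i ≡ end b
  link⇒ x i b p with x ≟ⱽ terminal (side b) | i ≟ end b
  ... | yes e | yes f = e , f

  linked⇒ : ∀ x i → T (link x i true ∨ link x i false) → ∃ λ b → x ≡ terminal (side b) × i ≡ end b
  linked⇒ x i r with Equivalence.to (Boolₚ.T-∨ {link x i true}) r
  ... | inj₁ p = true , link⇒ x i true p
  ... | inj₂ p = false , link⇒ x i false p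

  nb-edgeᵂ : ∀ x y → x ≈ y → y ∈ nbᵂ x
  nb-edgeᵂ hub (rim i) _ = there (∈-map⁺ rim (∈-allFin i))
  nb-edgeᵂ hub (inner x) e with x ≟ⱽ terminal tip
  ... | yes refl = here refl
  nb-edgeᵂ (rim i) hub _ = here refl
  nb-edgeᵂ (rim i) (rim j) e with Equivalence.to (Boolₚ.T-∨ {next i j}) e
  ... | inj₁ p with next⇒ {i = i} {j = j} p
  ...   | k , refl , refl = there (there (here (≡-sym (after-inject₁ k))))
  nb-edgeᵂ (rim i) (rim j) e | inj₂ p with next⇒ {i = j} {j = i} p
  ...   | k , refl , refl = there (here refl)
  nb-edgeᵂ (rim i) (inner x) e with linked⇒ x i e
  ... | true  , refl , refl = there (here refl)
  ... | false , refl , refl = there (there (here (≡-sym after-end)))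
  nb-edgeᵂ (inner x) hub e with x ≟ⱽ terminal tip
  ... | yes refl = ∈-map⁺ place (nb-terminal tip)
  nb-edgeᵂ (inner x) (rim i) e with linked⇒ x i e
  ... | b , refl , refl = ∈-map⁺ place (nb-terminal (side b))
  nb-edgeᵂ (inner x) (inner y) e = ∈-map⁺ place (nb-edge e)

  nb-inner≤ : ∀ x {k} → length (nb x) ≤ k → length (nbᵂ (inner x)) ≤ k
  nb-inner≤ x = subst (_≤ _) (≡-sym (length-map place (nb x)))

  -- Rim vertices have degree 3. This leaves the edges inside the gadget and the edge between hub
  -- and tip, for which the gadget provides a cubic end.
  cubic-edgeᵂ : ∀ x y → x ≈ y → length (nbᵂ x) ≤ 3 ⊎ length (nbᵂ y) ≤ 3
  cubic-edgeᵂ (rim _) _ _ = inj₁ ℕₚ.≤-refl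
  cubic-edgeᵂ hub (rim _) _ = inj₂ ℕₚ.≤-refl
  cubic-edgeᵂ (inner _) (rim _) _ = inj₂ ℕₚ.≤-refl
  cubic-edgeᵂ hub (inner x) e with x ≟ⱽ terminal tip
  ... | yes refl = inj₂ (nb-inner≤ (terminal tip) cubic-tip)
  cubic-edgeᵂ (inner x) hub e with x ≟ⱽ terminal tip
  ... | yes refl = inj₁ (nb-inner≤ (terminal tip) cubic-tip)
  cubic-edgeᵂ (inner x) (inner y) e = Sum.map (nb-inner≤ x) (nb-inner≤ y) (cubic-edge e)

  length-rims : length rims ≡ 2 + r
  length-rims = ≡-trans (length-map rim (allFin (2 + r))) (length-tabulate {n = 2 + r} (λ i → i))

  length-ws : length ws ≡ 3 + r + length vs
  length-ws = cong suc (≡-trans (length-++ rims) (cong₂ _+_ length-rims (length-map inner vs)))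

  nb≤ᵂ : excess ≤ r → ∀ x → length (nbᵂ x) ≤ 3 + r
  nb≤ᵂ ex hub       = ℕₚ.≤-reflexive (cong suc length-rims)
  nb≤ᵂ ex (rim i)   = ℕₚ.m≤m+n 3 r
  nb≤ᵂ ex (inner x) = nb-inner≤ x (ℕₚ.≤-trans (nb≤ x) (ℕₚ.+-monoʳ-≤ 3 ex))

  Realised : ℕ → Set
  Realised n = Σ (Graph n) λ G → MinHamConnected G × MaxDegree G (3 + r)

  -- `excess ≤ r` ensures that no vertex of the gadget has larger degree than the hub.
  realised : excess ≤ r → Realised (3 + r + length vs)
  realised ex = subst Realised length-ws (graph , minimal ,
    maxDegree (3 + r) (nb≤ᵂ ex) hub
      (¬Any⇒All¬ _ (λ p → case ∈-map⁻ rim p of λ ()) ∷ Unique-map⁺ (λ { refl → refl }) (allFin⁺ _))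
      (λ { (here refl) → tip≈hub ; (there p) → case ∈-map⁻ rim p of λ { (_ , _ , refl) → tt } })
      (cong suc length-rims))
    where
    4≤length : 4 ≤ length ws
    4≤length = subst (4 ≤_) (≡-sym length-ws)
      (ℕₚ.≤-trans (ℕₚ.+-monoʳ-≤ 3 (nonempty (vs-full (terminal tip)))) (ℕₚ.+-monoˡ-≤ (length vs) (ℕₚ.m≤m+n 3 r)))
      where
      nonempty : ∀ {x : V} {l} → x ∈ l → 1 ≤ length l
      nonempty (here _)  = s≤s z≤n
      nonempty (there _) = s≤s z≤n
    open Realise ws ws! ws-full edgeᵂ edgeᵂ-sym edgeᵂ-irr ham nbᵂ
           nb-edgeᵂ cubic-edgeᵂ 4≤length

-- Realising all admissible orders and degrees

add-rungs : ℕ → Gadget → Gadget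
add-rungs zero    X = X
add-rungs (suc k) X = Rung.gadget (add-rungs k X)

order : Gadget → ℕ
order X = length (Gadget.vs X)

order-add-rungs : ∀ k X → order (add-rungs k X) ≡ k * 2 + order X
order-add-rungs zero    X = refl
order-add-rungs (suc k) X = ≡-trans (Rung.length-vs (add-rungs k X)) (cong (2 +_) (order-add-rungs k X))

excess-add-rungs : ∀ k X → Gadget.excess (add-rungs k X) ≡ Gadget.excess X
excess-add-rungs zero    X = refl
excess-add-rungs (suc k) X = excess-add-rungs k X

Realisable : ℕ → ℕ → Set
Realisable n Δ = Σ (Graph n) λ G → MinHamConnected G × MaxDegree G Δ

realise : ∀ r k X → Gadget.excess X ≤ r → Realisable (3 + r + (k * 2 + order X)) (3 + r)
realise r k X ex = subst (λ m → Realisable (3 + r + m) (3 + r)) (order-add-rungs k X)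
  (Fan.realised (add-rungs k X) r (subst (_≤ r) (≡-sym (excess-add-rungs k X)) ex))

-- Here s stands for n - Δ, so the excluded values 0 and 2 mean Δ = n and Δ = n - 2. The point has
-- order 1, the diamond order 4, and each rung adds 2.
gadget-order : ∀ s → s ≢ 0 → s ≢ 2 → (∃ λ k → s ≡ k * 2 + 1) ⊎ (∃ λ k → s ≡ k * 2 + 4)
gadget-order 0 s≢0 _ = ⊥-elim (s≢0 refl)
gadget-order 1 _ _ = inj₁ (0 , refl)
gadget-order 2 _ s≢2 = ⊥-elim (s≢2 refl)
gadget-order 3 _ _ = inj₁ (1 , refl)
gadget-order 4 _ _ = inj₂ (0 , refl)
-- The smaller `s` is at least 3, so the recursion never meets the excluded 0 and 2.
gadget-order (suc (suc s@(suc (suc (suc _))))) _ _ with gadget-order s (λ ()) (λ ())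
... | inj₁ (k , e) = inj₁ (suc k , cong (2 +_) e)
... | inj₂ (k , e) = inj₂ (suc k , cong (2 +_) e)

theorem1 : (n Δ : ℕ) → 4 ≤ n →
    (Σ (Graph n) (λ G → MinHamConnected G × MaxDegree G Δ))
    ⇔ (3 ≤ Δ × Δ ≤ n ∸ 1 × Δ ≢ n ∸ 2 × (Δ ≡ 3 → 2 ∣ n))
theorem1 n Δ 4≤n = mk⇔ (λ (G , min , max) → degree-restrictions G 4≤n min max) construct
  where
  construct : 3 ≤ Δ × Δ ≤ n ∸ 1 × Δ ≢ n ∸ 2 × (Δ ≡ 3 → 2 ∣ n) → Realisable n Δ
  construct (s≤s (s≤s (s≤s {n = r} z≤n)) , Δ<n , Δ≢ , even) =
    subst (λ m → Realisable m (3 + r)) n≡ (by-order (gadget-order s s≢0 s≢2))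
    where
    s = n ∸ (3 + r)
    n≡ : 3 + r + s ≡ n
    n≡ = ℕₚ.m+[n∸m]≡n (ℕₚ.≤-trans Δ<n (ℕₚ.m∸n≤m n 1))
    s≢0 : s ≢ 0
    s≢0 e = ℕₚ.1+n≰n (subst (λ m → 3 + r ≤ m ∸ 1)
      (≡-trans (≡-sym n≡) (≡-trans (cong (3 + r +_) e) (ℕₚ.+-identityʳ (3 + r)))) Δ<n)
    s≢2 : s ≢ 2
    s≢2 e = Δ≢ (≡-sym (≡-trans (cong (_∸ 2) (≡-trans (≡-sym n≡) (cong (3 + r +_) e))) (ℕₚ.m+n∸n≡m (3 + r) 2)))
    by-order : (∃ λ k → s ≡ k * 2 + 1) ⊎ (∃ λ k → s ≡ k * 2 + 4) → Realisable (3 + r + s) (3 + r)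
    by-order (inj₁ (k , e)) = subst (λ m → Realisable (3 + r + m) (3 + r)) (≡-sym e) (realise r k point z≤n)
    by-order (inj₂ (k , e)) = subst (λ m → Realisable (3 + r + m) (3 + r)) (≡-sym e) (realise r k Diamond.gadget 1≤r)
      where
      -- The diamond has a vertex of degree 4, so Δ has to be at least 4. If r were 0, then Δ = 3
      -- and n = 3 + 2k + 4 = 2k + 7 would be odd.
      1≤r : 1 ≤ r
      1≤r = by-parity r even (≡-trans (cong (3 + r +_) (≡-sym e)) n≡)
        where
        by-parity : ∀ r → (3 + r ≡ 3 → 2 ∣ n) → 3 + r + (k * 2 + 4) ≡ n → 1 ≤ r
        by-parity (suc r) _ _ = s≤s z≤n
        by-parity zero even n≡ = ⊥-elim (toWitnessFalse {a? = 2 ∣? 7} tt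
          (∣m+n∣m⇒∣n (subst (2 ∣_) (≡-trans (≡-sym n≡) 3+k+4≡k+7) (even refl)) (n∣m*n k)))
          where
          3+k+4≡k+7 : 3 + (k * 2 + 4) ≡ k * 2 + 7
          3+k+4≡k+7 = ≡-trans (ℕₚ.+-comm 3 (k * 2 + 4)) (ℕₚ.+-assoc (k * 2) 4 3)
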